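{- Let $n\ge1$. The map $\psi_B=\varphi_B\circ\phi^{\mathrm{NC}}_B$ is a bijection between $\mathrm{NC}_B(n)$ and $\mathfrak{B}(n)$. Moreover, if $\psi_B(\pi)=(\sigma,x)$, then $\operatorname{type}(\pi)=\operatorname{type}(\sigma)$ if $x$ is not a block, and $\operatorname{type}(\pi)=\operatorname{type}(\sigma\setminus\{x\})$ if $x$ is a block.
   Context: $[n]=\{1,\dots,n\}$, $[\pm n]=\{\pm1,\dots,\pm n\}$. An edge of a partition of a set of integers is a pair $(i,j)$, $i<j$, in the same block with no element of that block strictly between. $\mathrm{NC}(n)$: partitions of $[n]$ with no two edges $(a,b),(c,d)$, $a<c<b<d$. A block $B$ of $\sigma$ is nonnested if no edge $(i,j)$ satisfies $i<\min B\le\max B<j$. $\mathrm{NC}^{\mathrm{NN}}(n)$ is the set of pairs $(\sigma,X)$ with $\sigma\in\mathrm{NC}(n)$ and $X$ a set of nonnested blocks of $\sigma$. A partition of type $B_n$ is a set partition of $[\pm n]$ with $-B$ a block whenever $B$ is and at most one block (zero block) with $B=-B$. $\mathrm{NC}_B(n)$ is the set of such partitions $\pi$ with no $i<j<k<l$ such that $a_i,a_k\in B$, $a_j,a_l\in B'$ for distinct blocks $B,B'$, where $a_1,\dots,a_{2n}$ is the sequence $1,2,\dots,n,-1,-2,\dots,-n$. $\phi^{\mathrm{NC}}_B(\pi)=(\sigma,X)$, where $\sigma$ is obtained from $\pi$ by deleting negative integers and $X$ is the set of blocks of $\sigma$ properly contained in blocks of $\pi$. $\mathfrak B(n)$ is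 the set of pairs $(\sigma,x)$ with $\sigma\in\mathrm{NC}(n)$ and $x$ either $\emptyset$, an edge of $\sigma$, or a block of $\sigma$. For $(\sigma,X)\in\mathrm{NC}^{\mathrm{NN}}(n)$ with $X=\{A_1,\dots,A_k\}$, $\max A_1<\cdots<\max A_k$, $\varphi_B(\sigma,X)=(\sigma',x)$ where $\sigma'$ is obtained from $\sigma$ by replacing $A_i$ and $A_{k+1-i}$ by their union for $i=1,\dots,\lfloor k/2\rfloor$, and $x=\emptyset$ if $k=0$, $x=(\max A_t,\min A_{t+1})$ if $k=2t\ne0$, $x=A_{t+1}$ if $k=2t+1$. Types: type of a collection of sets = multiset of their sizes; type of a partition $\pi$ of type $B_n$ = multiset containing $i$ with multiplicity the number of unordered pairs $\{B,-B\}$ of nonzero blocks of size $i$. -}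

module Defs where

open import Data.Nat as ℕ using (ℕ; zero; suc; _≤_; _<_; _+_; _∸_; _⊔_; _⊓_; _≤ᵇ_; _≡ᵇ_; _/_; _%_)
open import Data.Integer as ℤ using (ℤ; +_; -[1+_])
open import Data.List using (List; []; _∷_; map; length; _++_; take; reverse; zipWith; mapMaybe; foldr; applyUpTo; filterᵇ)
open import Data.Bool.ListAction using (any; all)
open import Data.List.Membership.Propositional using (_∈_)
open import Data.List.Relation.Unary.Any using (Any)
open import Data.List.Relation.Unary.All using (All)
open import Data.List.Relation.Unary.AllPairs using (AllPairs)
open import Data.List.Relation.Unary.Unique.Propositional using (Unique)
open import Data.Product using (_×_; _,_; Σ)
open import Data.Unit using (⊤)
open import Data.Empty using (⊥)
open import Data.Maybe using (Maybe; just; nothing)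
open import Data.Bool using (Bool; true; false; not; _∧_; if_then_else_)
open import Function.Bundles using (_⇔_)
open import Relation.Nullary using (¬_; does)
open import Relation.Binary.PropositionalEquality using (_≡_; _≢_)

_≋_ : {A : Set} → List A → List A → Set
B ≋ C = ∀ a → (a ∈ B) ⇔ (a ∈ C)

Disjoint : {A : Set} → List A → List A → Set
Disjoint B C = ∀ a → a ∈ B → a ∈ C → ⊥

record IsPartitionOf {A : Set} (S : List A) (P : List (List A)) : Set where
  field
    nonempty : All (λ B → B ≢ []) P
    blocksAreSets : All Unique P
    disjoint : AllPairs Disjoint P
    covers : ∀ a → a ∈ S → Any (a ∈_) P
    within : ∀ a B → B ∈ P → a ∈ B → a ∈ S

SameBlock : {A : Set} → List (List A) → A → A → Set
SameBlock P a b = Any (λ B → (a ∈ B) × (b ∈ B)) P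

-- equality of partitions (as sets of sets): same "lie in a common block" relation
_≈ₚ_ : {A : Set} → List (List A) → List (List A) → Set
P ≈ₚ Q = ∀ a b → SameBlock P a b ⇔ SameBlock Q a b

[_] : ℕ → List ℕ
[ n ] = applyUpTo suc n

IsEdge : List (List ℕ) → ℕ → ℕ → Set
IsEdge σ i j = Any (λ B → (i ∈ B) × (j ∈ B) × (i < j) × (∀ k → k ∈ B → i < k → k < j → ⊥)) σ

record IsNC (n : ℕ) (σ : List (List ℕ)) : Set where
  field
    partition : IsPartitionOf [ n ] σ
    noncrossing : ∀ a b c d → IsEdge σ a b → IsEdge σ c d → a < c → c < b → b < d → ⊥

negB : List ℤ → List ℤ
negB B = map ℤ.-_ B

-- the sequence a_1,…,a_{2n} = 1,2,…,n,-1,-2,…,-n  (a n i = a_i for 1 ≤ i ≤ 2n)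
a : ℕ → ℕ → ℤ
a n i = if i ≤ᵇ n then + i else ℤ.- (+ (i ∸ n))

[±_] : ℕ → List ℤ
[± n ] = applyUpTo (λ i → a n (suc i)) (n + n)

record IsNCB (n : ℕ) (π : List (List ℤ)) : Set where
  field
    partition : IsPartitionOf [± n ] π
    symmetric : ∀ B → B ∈ π → Any (_≋ negB B) π
    atMostOneZeroBlock : ∀ B C → B ∈ π → C ∈ π → B ≋ negB B → C ≋ negB C → B ≡ C
    noncrossing : ∀ B B' i j k l → B ∈ π → B' ∈ π → B ≢ B' →
      1 ≤ i → i < j → j < k → k < l → l ≤ n + n →
      a n i ∈ B → a n k ∈ B → a n j ∈ B' → a n l ∈ B' → ⊥

data Mark : Set where
  none  : Mark
  edge  : ℕ → ℕ → Mark
  block : List ℕ → Mark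

ValidMark : List (List ℕ) → Mark → Set
ValidMark σ none = ⊤
ValidMark σ (edge i j) = IsEdge σ i j
ValidMark σ (block B) = Any (B ≋_) σ

InFrakB : ℕ → List (List ℕ) × Mark → Set
InFrakB n (σ , x) = IsNC n σ × ValidMark σ x

MarkEq : Mark → Mark → Set
MarkEq none none = ⊤
MarkEq (edge i j) (edge k l) = (i ≡ k) × (j ≡ l)
MarkEq (block B) (block C) = B ≋ C
MarkEq _ _ = ⊥

_≈𝔅_ : List (List ℕ) × Mark → List (List ℕ) × Mark → Set
(σ , x) ≈𝔅 (τ , y) = (σ ≈ₚ τ) × MarkEq x y

memℕ : ℕ → List ℕ → Bool
memℕ x = any (λ y → does (x ℕ.≟ y))

memℤ : ℤ → List ℤ → Bool
memℤ x = any (λ y → does (x ℤ.≟ y))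

subℕ : List ℕ → List ℕ → Bool
subℕ B C = all (λ x → memℕ x C) B

subℤ : List ℤ → List ℤ → Bool
subℤ B C = all (λ x → memℤ x C) B

setEqℕ : List ℕ → List ℕ → Bool
setEqℕ B C = subℕ B C ∧ subℕ C B

setEqℤ : List ℤ → List ℤ → Bool
setEqℤ B C = subℤ B C ∧ subℤ C B

maxL : List ℕ → ℕ
maxL = foldr _⊔_ 0

minL : List ℕ → ℕ
minL [] = 0
minL (x ∷ xs) = foldr _⊓_ x xs

posPart : List ℤ → List ℕ
posPart = mapMaybe toPos
  where
  toPos : ℤ → Maybe ℕ
  toPos (+ suc k) = just (suc k)
  toPos (+ zero) = nothing
  toPos -[1+ k ] = nothing

nonEmptyᵇ : {A : Set} → List A → Bool
nonEmptyᵇ [] = false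
nonEmptyᵇ (_ ∷ _) = true

properSubᵇ : List ℕ → List ℤ → Bool
properSubᵇ C B = subℤ (map +_ C) B ∧ not (subℤ B (map +_ C))

φNCB : List (List ℤ) → List (List ℕ) × List (List ℕ)
φNCB π = σ , filterᵇ (λ C → any (properSubᵇ C) π) σ
  where
  σ : List (List ℕ)
  σ = filterᵇ nonEmptyᵇ (map posPart π)

insertByMax : List ℕ → List (List ℕ) → List (List ℕ)
insertByMax A [] = A ∷ []
insertByMax A (C ∷ Cs) = if maxL A ≤ᵇ maxL C then A ∷ C ∷ Cs else C ∷ insertByMax A Cs

sortByMax : List (List ℕ) → List (List ℕ)
sortByMax = foldr insertByMax []

nth : List (List ℕ) → ℕ → List ℕ
nth [] _ = []
nth (x ∷ xs) zero = x
nth (x ∷ xs) (suc i) = nth xs i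

φB : List (List ℕ) × List (List ℕ) → List (List ℕ) × Mark
φB (σ , X) = (rest ++ merged ++ middle) , x
  where
  As : List (List ℕ)
  As = sortByMax X
  k : ℕ
  k = length As
  t : ℕ
  t = k / 2
  rest : List (List ℕ)
  rest = filterᵇ (λ C → not (any (setEqℕ C) X)) σ
  merged : List (List ℕ)
  merged = zipWith _++_ (take t As) (take t (reverse As))
  middle : List (List ℕ)
  middle = if k % 2 ≡ᵇ 1 then nth As t ∷ [] else []
  x : Mark
  x = if k ≡ᵇ 0 then none
      else if k % 2 ≡ᵇ 0 then edge (maxL (nth As (t ∸ 1))) (minL (nth As t))
      else block (nth As t)

ψB : List (List ℤ) → List (List ℕ) × Mark
ψB π = φB (φNCB π)

-- Types (multisets of positive integers as multiplicity functions ℕ → ℕ)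

typeC : List (List ℕ) → ℕ → ℕ
typeC σ i = length (filterᵇ (λ B → length B ≡ᵇ i) σ)

-- type of a partition of type B_n: multiplicity of i = number of unordered pairs
-- {B , -B} of nonzero blocks of size i = (number of nonzero blocks of size i) / 2
typeB : List (List ℤ) → ℕ → ℕ
typeB π i = length (filterᵇ (λ B → not (setEqℤ B (negB B)) ∧ (length B ≡ᵇ i)) π) / 2

removeBlock : List (List ℕ) → List ℕ → List (List ℕ)
removeBlock σ B = filterᵇ (λ C → not (setEqℕ C B)) σ

SameType : (ℕ → ℕ) → (ℕ → ℕ) → Set
SameType f g = ∀ i → f i ≡ g i

TypeClause : List (List ℤ) → List (List ℕ) × Mark → Set
TypeClause π (σ , none) = SameType (typeB π) (typeC σ)
TypeClause π (σ , edge _ _) = SameType (typeB π) (typeC σ)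
TypeClause π (σ , block x) = SameType (typeB π) (typeC (removeBlock σ x))

-- A symmetric partition π of [±n] is encoded by two relations on [n]: P i j (i and j share a block)
-- and M i j (i and -j share a block). The mixed blocks of the positive part are unnested, hence linearly
-- ordered, and the noncrossing condition makes "contains the negatives of" an order-reversing involution on
-- them, so it pairs the i-th block with the i-th from the end. Hence the partition σ of (σ , x) = ψB π is the
-- equivalence relation P ∪ M, and x is read off the innermost pair: it is empty, the innermost edge, or the
-- zero block. Conversely x determines a threshold θ (the lower end of the edge, or any element of the zero
-- block) such that two elements of a block of σ other than the zero block are P-related when they lie on the
-- same side of θ and M-related otherwise. This recovers π from (σ , x), and the explicit inverse built from
-- it sends each unmarked block of σ to two opposite blocks of the same size, which gives the types.
module Submission where

open import Defs
open import Data.Nat as ℕ using (ℕ; zero; suc; _≤_; _<_; _≤ᵇ_; _≡ᵇ_; _+_; _∸_; _*_; _/_; _%_; _⊓_; z≤n; s≤s)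
open import Data.Nat.Properties
open import Data.Nat.Divisibility using (n∣m*n)
open import Data.Nat.DivMod using (m*n/n≡m; m*n%n≡0; [m+kn]%n≡m%n; +-distrib-/-∣ʳ)
open import Data.Integer as ℤ using (ℤ; +_; -[1+_]; ∣_∣)
import Data.Integer.Properties as ℤ
open import Data.Bool using (Bool; true; false; not; T; if_then_else_; _∧_; _xor_)
open import Data.Bool.ListAction using (any; all)
open import Data.Bool.Properties using (T?; T-≡; T-∧)
open import Data.Empty using (⊥; ⊥-elim)
open import Data.List using (List; []; _∷_; map; length; _++_; take; reverse; zipWith; filterᵇ; foldr; concatMap)
open import Data.List.Properties using (≡-dec; length-++; length-map; length-reverse; reverse-++; unfold-reverse; ++-assoc; filter-++)
open import Data.List.Membership.DecPropositional ℕ._≟_ using (_∈?_)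
open import Data.List.Membership.Propositional using (_∈_; find; lose)
open import Data.List.Membership.Propositional.Properties
open import Data.List.Relation.Binary.Permutation.Propositional using (_↭_; prep; swap; ↭-refl; ↭-sym; ↭-trans; ↭-reflexive; ↭⇒↭ₛ)
open import Data.List.Relation.Binary.Permutation.Propositional.Properties hiding (++-assoc)
import Data.List.Relation.Binary.Permutation.Setoid.Properties as ↭ₛ
open import Data.List.Relation.Binary.Pointwise using (Pointwise; []; _∷_)
open import Data.List.Relation.Unary.All as All using (All; []; _∷_)
open import Data.List.Relation.Unary.All.Properties using (all⁺; all⁻; ¬All⇒Any¬)
open import Data.List.Relation.Unary.AllPairs as AllPairs using (AllPairs; []; _∷_)
import Data.List.Relation.Unary.AllPairs.Properties as AllPairs
open import Data.List.Relation.Unary.Any as Any using (Any; here; there; any?)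
open import Data.List.Relation.Unary.Any.Properties using (any⁺; any⁻)
open import Data.List.Relation.Unary.Unique.Propositional using (Unique)
import Data.List.Relation.Unary.Unique.Propositional.Properties as Unique
open import Data.Product using (_×_; _,_; proj₁; proj₂; ∃-syntax)
open import Data.Sum using (_⊎_; inj₁; inj₂; [_,_]′)
open import Data.Unit using (⊤; tt)
open import Function.Base using (_∘_)
open import Function.Bundles using (_⇔_; mk⇔; Equivalence)
open import Relation.Binary.Definitions using (tri<; tri≈; tri>)
open import Relation.Binary.PropositionalEquality using (_≡_; _≢_; refl; sym; trans; cong; cong₂; subst; setoid; resp₂)
open import Relation.Nullary using (¬_; Dec; yes; no; does; contradiction)
open import Relation.Nullary.Decidable using (_×-dec_)

open Equivalence using (to; from)

-- `φB` sorts, reverses, zips and divides by two, which is awkward to mix with arguments about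
-- blocks. Its list computation is therefore confined to the lemmas that end in `φB-correct`; their
-- outcome is that the value satisfies `Spec`, a condition on relations alone. `Spec` determines the
-- value up to `≈𝔅`, and through the threshold the value determines P and M. Independence of the
-- representing list, injectivity and surjectivity follow without looking at `φB` again. Sizes are
-- not traced through the merging either: π agrees with the inverse image of its own value, where
-- they can be counted. Mixed blocks are unnested because, if j lies between elements i < k of
-- another block and shares a block with -l, then the pairs i, k and j, -l alternate in the
-- sequence. The pairing reverses the order because for i < j and k < l the pairs i, -k and j, -l
-- alternate. The threshold works because a pair of opposite signs on one side of it would alternate
-- with the innermost pair and turn that pair into a zero block.

record NonCrossing (S : ℕ → ℕ → Set) : Set where
  field
    S-pos : ∀ {i j} → S i j → 1 ≤ i
    S-sym : ∀ {i j} → S i j → S j i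
    S-trans : ∀ {i j k} → S i j → S j k → S i k
    cross : ∀ {i j k l} → i < j → j < k → k < l → S i k → S j l → S i j

-- The three rules forbid alternating pairs for the sign patterns ++++, +++- and ++--. Since -l
-- stands at index n + l, behind every positive integer, `crossPM` leaves l free and `crossMM` does
-- not compare j with k. Patterns with more negatives reduce to these by negation.
record SignedNonCrossing (P M : ℕ → ℕ → Set) : Set where
  field
    P-pos : ∀ {i j} → P i j → 1 ≤ i
    M-pos : ∀ {i j} → M i j → 1 ≤ i
    P-sym : ∀ {i j} → P i j → P j i
    M-sym : ∀ {i j} → M i j → M j i
    PP : ∀ {i j k} → P i j → P j k → P i k
    PM : ∀ {i j k} → P i j → M j k → M i k
    MM : ∀ {i j k} → M i j → M j k → P i k
    crossPP : ∀ {i j k l} → i < j → j < k → k < l → P i k → P j l → P i j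
    crossPM : ∀ {i j k l} → i < j → j < k → P i k → M j l → P i j
    crossMM : ∀ {i j k l} → i < j → k < l → M i k → M j l → P i j

  MP : ∀ {i j k} → M i j → P j k → M i k
  MP m p = M-sym (PM (P-sym p) (M-sym m))

  M-refl : ∀ {i j} → M i j → P i i
  M-refl m = MM m (M-sym m)

-- This describes the mark without reference to a sorted list of blocks: p and q are the consecutive
-- mixed elements around the centre, and `M i i` says that i lies in the zero block.
MarkSpec : (P M : ℕ → ℕ → Set) → Mark → Set
MarkSpec P M none = ∀ i j → ¬ M i j
MarkSpec P M (edge p q) = p < q × M p q × (∀ k l → M k l → p < k → k < q → ⊥) × (∀ i → ¬ M i i)
MarkSpec P M (block B) = (∃[ z ] z ∈ B) × (∀ i → (i ∈ B) ⇔ M i i)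

Spec : (P M : ℕ → ℕ → Set) → List (List ℕ) × Mark → Set
Spec P M (σ , x) = (∀ i j → SameBlock σ i j ⇔ (P i j ⊎ M i j)) × MarkSpec P M x

RelValid : (ℕ → ℕ → Set) → Mark → Set
RelValid S none = ⊤
RelValid S (edge p q) = S p q × p < q × (∀ k → p < k → k < q → S p k → ⊥)
RelValid S (block B) = (∃[ z ] z ∈ B) × (∀ i j → i ∈ B → S i j ⇔ (j ∈ B))

-- With threshold 0 all positive integers lie on the upper side, so that no pair gets opposite
-- signs. The value at `block []` is a dummy; `MarkSpec` and `RelValid` both demand a nonempty
-- block.
threshold : Mark → ℕ
threshold none = 0
threshold (edge p q) = p
threshold (block []) = 0
threshold (block (z ∷ _)) = z

InZero : Mark → ℕ → Set
InZero (block B) i = i ∈ B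
InZero _ i = ⊥

SameSide OppSide : ℕ → ℕ → ℕ → Set
SameSide θ i j = (i ≤ᵇ θ) ≡ (j ≤ᵇ θ)
OppSide θ i j = (i ≤ᵇ θ) ≡ not (j ≤ᵇ θ)

data Side (θ i : ℕ) : Set where
  low  : i ≤ θ → (i ≤ᵇ θ) ≡ true → Side θ i
  high : θ < i → (i ≤ᵇ θ) ≡ false → Side θ i

side : ∀ θ i → Side θ i
side θ i with i ≤ᵇ θ in eq
... | true = low (≤ᵇ⇒≤ i θ (from T-≡ eq)) eq
... | false = high (≰⇒> λ le → contradiction (trans (sym eq) (to T-≡ (≤⇒≤ᵇ le))) λ ()) eq

same⊎opp : ∀ θ i j → SameSide θ i j ⊎ OppSide θ i j
same⊎opp θ i j with i ≤ᵇ θ | j ≤ᵇ θ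
... | true | true = inj₁ refl
... | true | false = inj₂ refl
... | false | true = inj₂ refl
... | false | false = inj₁ refl

¬same×opp : ∀ θ i j → SameSide θ i j → OppSide θ i j → ⊥
¬same×opp θ i j s o with j ≤ᵇ θ
... | true = contradiction (trans (sym s) o) λ ()
... | false = contradiction (trans (sym s) o) λ ()

-- Outside the zero block exactly one of the two relations holds for an S-related pair; inside it
-- both do.
SignP SignM : (ℕ → ℕ → Set) → Mark → ℕ → ℕ → Set
SignP S x i j = S i j × (InZero x i ⊎ SameSide (threshold x) i j)
SignM S x i j = S i j × (InZero x i ⊎ OppSide (threshold x) i j)

-- Reading the signs off the mark

module _ {P M : ℕ → ℕ → Set} (sn : SignedNonCrossing P M) where
  open SignedNonCrossing sn

  -- `crossPM` against the pair p, q moves the left element to p. Then j strictly before q is a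
  -- mixed element in the gap, while j at or beyond q puts p and q in one positive block and hence
  -- makes that block a zero block.
  edge-P-side : ∀ {p q} → MarkSpec P M (edge p q) → ∀ {i j} → P i j → i ≤ p → p < j → ⊥
  edge-P-side {p} {q} (p<q , mpq , gap , nz) {i} {j} pij i≤p p<j = go (m≤n⇒m<n∨m≡n i≤p)
    where
    ppj→⊥ : P p j → ⊥
    ppj→⊥ ppj with <-cmp j q
    ... | tri< j<q _ _ = gap j q (PM (P-sym ppj) mpq) p<j j<q
    ... | tri≈ _ refl _ = nz p (MP mpq (P-sym ppj))
    ... | tri> _ _ q<j = nz p (MP mpq (P-sym (crossPM p<q q<j ppj (M-sym mpq))))
    go : i < p ⊎ i ≡ p → ⊥
    go (inj₁ i<p) = ppj→⊥ (PP (P-sym (crossPM i<p p<j pij mpq)) pij)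
    go (inj₂ refl) = ppj→⊥ pij

  -- Comparison with the pair p, q by `crossMM` places both i and j in the block of p, so that
  -- `M i j` would become `M p p`.
  edge-M-low : ∀ {p q} → MarkSpec P M (edge p q) → ∀ {i j} → M i j → i ≤ p → j ≤ p → ⊥
  edge-M-low {p} {q} (p<q , mpq , _ , nz) mij i≤p j≤p =
    nz p (PM (P-sym (near mij i≤p j≤p)) (MP mij (near (M-sym mij) j≤p i≤p)))
    where
    near : ∀ {i j} → M i j → i ≤ p → j ≤ p → P i p
    near m i≤p j≤p with m≤n⇒m<n∨m≡n i≤p
    ... | inj₁ i<p = crossMM i<p (≤-<-trans j≤p p<q) m mpq
    ... | inj₂ refl = M-refl m

  -- The mirror image of `edge-M-low`, with q in the role of p: the gap pushes the mixed elements i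
  -- and j to q or beyond.
  edge-M-high : ∀ {p q} → MarkSpec P M (edge p q) → ∀ {i j} → M i j → p < i → p < j → ⊥
  edge-M-high {p} {q} (p<q , mpq , gap , nz) mij p<i p<j =
    nz q (PM (near mij p<i p<j) (MP mij (P-sym (near (M-sym mij) p<j p<i))))
    where
    near : ∀ {i j} → M i j → p < i → p < j → P q i
    near {i} {j} m p<i p<j with <-cmp i q
    ... | tri< i<q _ _ = ⊥-elim (gap i j m p<i i<q)
    ... | tri≈ _ refl _ = M-refl m
    ... | tri> _ _ q<i = crossMM q<i p<j (M-sym mpq) m

  module _ {z : ℕ} {B : List ℕ} (ms : MarkSpec P M (block (z ∷ B))) where
    private
      mzz : M z z
      mzz = to (proj₂ ms z) (here refl)

      zero-class : ∀ {i} → P i z → i ∈ z ∷ B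
      zero-class p = from (proj₂ ms _) (PM p (MP mzz (P-sym p)))

      zero-partner : ∀ {i j} → M i j → P j z → i ∈ z ∷ B
      zero-partner m p = zero-class (MM m (PM p mzz))

    -- The pair z, -z replaces the pair p, -q of the edge case. What was a contradiction there is
    -- membership in the zero block here.
    block-P-side : ∀ {i j} → P i j → i ≤ z → z < j → i ∈ z ∷ B
    block-P-side pij i≤z z<j with m≤n⇒m<n∨m≡n i≤z
    ... | inj₁ i<z = zero-class (crossPM i<z z<j pij mzz)
    ... | inj₂ refl = here refl

    block-M-low : ∀ {i j} → M i j → i ≤ z → j ≤ z → i ∈ z ∷ B
    block-M-low mij i≤z j≤z with m≤n⇒m<n∨m≡n i≤z | m≤n⇒m<n∨m≡n j≤z
    ... | inj₂ refl | _ = here refl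
    ... | _ | inj₂ refl = zero-partner mij (M-refl mzz)
    ... | inj₁ i<z | inj₁ j<z = zero-class (crossMM i<z j<z mij mzz)

    block-M-high : ∀ {i j} → M i j → z < i → z < j → i ∈ z ∷ B
    block-M-high mij z<i z<j = zero-class (P-sym (crossMM z<i z<j mzz mij))

    in-zero-P : ∀ {i j} → P i j → j ∈ z ∷ B → i ∈ z ∷ B
    in-zero-P p j∈ = from (proj₂ ms _) (PM p (MP (to (proj₂ ms _) j∈) (P-sym p)))

  P-side : ∀ x → MarkSpec P M x → ∀ {i j} → P i j → InZero x i ⊎ SameSide (threshold x) i j
  P-side none ms {i} {j} pij with side 0 i | side 0 j
  ... | high _ e | high _ e' = inj₂ (trans e (sym e'))
  -- P-related elements are at least 1, so neither can be at or below the threshold 0.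
  ... | low i≤0 _ | _ = contradiction (≤-trans (P-pos pij) i≤0) 1+n≰n
  ... | _ | low j≤0 _ = contradiction (≤-trans (P-pos (P-sym pij)) j≤0) 1+n≰n
  P-side (edge p q) ms {i} {j} pij with side p i | side p j
  ... | low _ e | low _ e' = inj₂ (trans e (sym e'))
  ... | high _ e | high _ e' = inj₂ (trans e (sym e'))
  ... | low i≤ _ | high <j _ = ⊥-elim (edge-P-side ms pij i≤ <j)
  ... | high <i _ | low j≤ _ = ⊥-elim (edge-P-side ms (P-sym pij) j≤ <i)
  P-side (block []) ((_ , ()) , _)
  P-side (block (z ∷ B)) ms {i} {j} pij with side z i | side z j
  ... | low _ e | low _ e' = inj₂ (trans e (sym e'))
  ... | high _ e | high _ e' = inj₂ (trans e (sym e'))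
  ... | low i≤ _ | high <j _ = inj₁ (block-P-side ms pij i≤ <j)
  ... | high <i _ | low j≤ _ = inj₁ (in-zero-P ms pij (block-P-side ms (P-sym pij) j≤ <i))

  M-side : ∀ x → MarkSpec P M x → ∀ {i j} → M i j → InZero x i ⊎ OppSide (threshold x) i j
  M-side none ms mij = ⊥-elim (ms _ _ mij)
  M-side (edge p q) ms {i} {j} mij with side p i | side p j
  ... | low i≤ _ | low j≤ _ = ⊥-elim (edge-M-low ms mij i≤ j≤)
  ... | high <i _ | high <j _ = ⊥-elim (edge-M-high ms mij <i <j)
  ... | low _ e | high _ e' = inj₂ (trans e (cong not (sym e')))
  ... | high _ e | low _ e' = inj₂ (trans e (cong not (sym e')))
  M-side (block []) ((_ , ()) , _)
  M-side (block (z ∷ B)) ms {i} {j} mij with side z i | side z j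
  ... | low i≤ _ | low j≤ _ = inj₁ (block-M-low ms mij i≤ j≤)
  ... | high <i _ | high <j _ = inj₁ (block-M-high ms mij <i <j)
  ... | low _ e | high _ e' = inj₂ (trans e (cong not (sym e')))
  ... | high _ e | low _ e' = inj₂ (trans e (cong not (sym e')))

  zero-M : ∀ x → MarkSpec P M x → ∀ {i} → InZero x i → M i i
  zero-M (block B) ms i∈ = to (proj₂ ms _) i∈

  -- The blocks of σ only show P ∪ M. A pair that is M-related although its sides agree must lie in
  -- the zero block, where M implies P. With its companion for M this is the source of injectivity.
  P⇔SignP : ∀ {σ x} → Spec P M (σ , x) → ∀ i j → P i j ⇔ SignP (SameBlock σ) x i j
  P⇔SignP {σ} {x} (same , ms) i j = mk⇔ (λ p → from (same i j) (inj₁ p) , P-side x ms p) back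
    where
    back : SignP (SameBlock σ) x i j → P i j
    back (s , c) with to (same i j) s
    ... | inj₁ p = p
    ... | inj₂ m with c | M-side x ms m
    ... | inj₁ iz | _ = MM (zero-M x ms iz) m
    ... | inj₂ _ | inj₁ iz = MM (zero-M x ms iz) m
    ... | inj₂ ss | inj₂ os = ⊥-elim (¬same×opp (threshold x) i j ss os)

  M⇔SignM : ∀ {σ x} → Spec P M (σ , x) → ∀ i j → M i j ⇔ SignM (SameBlock σ) x i j
  M⇔SignM {σ} {x} (same , ms) i j = mk⇔ (λ m → from (same i j) (inj₂ m) , M-side x ms m) back
    where
    back : SignM (SameBlock σ) x i j → M i j
    back (s , c) with to (same i j) s
    ... | inj₂ m = m
    ... | inj₁ p with c | P-side x ms p
    ... | inj₁ iz | _ = MP (zero-M x ms iz) p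
    ... | inj₂ _ | inj₁ iz = MP (zero-M x ms iz) p
    ... | inj₂ os | inj₂ ss = ⊥-elim (¬same×opp (threshold x) i j ss os)

  union-nonCrossing : NonCrossing (λ i j → P i j ⊎ M i j)
  union-nonCrossing = record
    { S-pos = [ P-pos , M-pos ]′
    ; S-sym = λ { (inj₁ p) → inj₁ (P-sym p) ; (inj₂ m) → inj₂ (M-sym m) }
    ; S-trans = λ { (inj₁ p) (inj₁ q) → inj₁ (PP p q) ; (inj₁ p) (inj₂ m) → inj₂ (PM p m)
                  ; (inj₂ m) (inj₁ p) → inj₂ (MP m p) ; (inj₂ m) (inj₂ m') → inj₁ (MM m m') }
    ; cross = λ
      { a b c (inj₁ p) (inj₁ q) → inj₁ (crossPP a b c p q)
      ; a b c (inj₁ p) (inj₂ m) → inj₁ (crossPM a b p m)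
      -- Here the rule is applied to j < k < l with the pair k, -i; it yields `P j k`, which turns
      -- `M i k` into `M i j`.
      ; a b c (inj₂ m) (inj₁ q) → inj₂ (MP m (P-sym (crossPM b c q (M-sym m))))
      ; a b c (inj₂ m) (inj₂ m') → inj₁ (crossMM a c m m') } }

  markSpec⇒relValid : ∀ x → MarkSpec P M x → RelValid (λ i j → P i j ⊎ M i j) x
  markSpec⇒relValid none _ = tt
  markSpec⇒relValid (edge p q) (p<q , mpq , gap , nz) = inj₂ mpq , p<q , λ
    { k p<k k<q (inj₁ ppk) → gap k q (PM (P-sym ppk) mpq) p<k k<q
    ; k p<k k<q (inj₂ mpk) → gap k p (M-sym mpk) p<k k<q }
  markSpec⇒relValid (block B) (z∈ , zeros) = z∈ , λ i j i∈ → mk⇔ (fwd (to (zeros i) i∈))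
    (λ j∈ → inj₁ (together (to (zeros i) i∈) (to (zeros j) j∈)))
    where
    fwd : ∀ {i j} → M i i → P i j ⊎ M i j → j ∈ B
    fwd mii (inj₁ p) = from (zeros _) (PM (P-sym p) (MP mii p))
    fwd mii (inj₂ m) = from (zeros _) (PM (P-sym (MM mii m)) m)
    together : ∀ {i j} → M i i → M j j → P i j
    together {i} {j} mi mj with <-cmp i j
    ... | tri< i<j _ _ = crossMM i<j i<j mi mj
    ... | tri≈ _ refl _ = M-refl mi
    ... | tri> _ _ j<i = P-sym (crossMM j<i j<i mj mi)

  -- If p < p', the pair p', q' of opposite signs would lie entirely above the threshold p.
  edge-unique-low : ∀ {p q p' q'} → MarkSpec P M (edge p q) → MarkSpec P M (edge p' q') → p' ≤ p
  edge-unique-low {p} ms (p'<q' , m' , _) = ≮⇒≥ λ p<p' → edge-M-high ms m' p<p' (<-trans p<p' p'<q')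

  edge-unique : ∀ {p q p' q'} → MarkSpec P M (edge p q) → MarkSpec P M (edge p' q') → (p ≡ p') × (q ≡ q')
  edge-unique {p} {q} {p'} {q'} ms ms' with ≤-antisym (edge-unique-low ms' ms) (edge-unique-low ms ms')
  edge-unique {p} {q} {p'} {q'} (p<q , m , gap , _) (p<q' , m' , gap' , _) | refl with <-cmp q q'
  ... | tri≈ _ refl _ = refl , refl
  ... | tri< q<q' _ _ = ⊥-elim (gap' q p (M-sym m) p<q q<q')
  ... | tri> _ _ q'<q = ⊥-elim (gap q' p (M-sym m') p<q' q'<q)

  mark-unique : ∀ x y → MarkSpec P M x → MarkSpec P M y → MarkEq x y
  mark-unique none none _ _ = tt
  mark-unique none (edge p q) ms (_ , m , _) = ms _ _ m
  mark-unique none (block B) ms ((z , z∈) , zeros) = ms _ _ (to (zeros z) z∈)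
  mark-unique (edge p q) none (_ , m , _) ms = ms _ _ m
  mark-unique (edge p q) (edge _ _) ms ms' = edge-unique ms ms'
  mark-unique (edge p q) (block B) (_ , _ , _ , nz) ((z , z∈) , zeros) = nz z (to (zeros z) z∈)
  mark-unique (block B) none ((z , z∈) , zeros) ms = ms _ _ (to (zeros z) z∈)
  mark-unique (block B) (edge p q) ((z , z∈) , zeros) (_ , _ , _ , nz) = nz z (to (zeros z) z∈)
  mark-unique (block B) (block C) (_ , zeros) (_ , zeros') i =
    mk⇔ (λ i∈ → from (zeros' i) (to (zeros i) i∈)) (λ i∈ → from (zeros i) (to (zeros' i) i∈))

  -- To compare two values it suffices that both meet `Spec` for the same relations. Independence of
  -- the representing list and surjectivity both rest on this.
  spec-unique : ∀ {y y'} → Spec P M y → Spec P M y' → y ≈𝔅 y'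
  spec-unique {_ , x} {_ , x'} (same , ms) (same' , ms') =
    (λ i j → mk⇔ (λ s → from (same' i j) (to (same i j) s)) (λ s → from (same i j) (to (same' i j) s)))
    , mark-unique x x' ms ms'

-- Transport along equivalent relations

signed-resp : ∀ {P M P' M' : ℕ → ℕ → Set} → (∀ i j → P i j ⇔ P' i j) → (∀ i j → M i j ⇔ M' i j) →
  SignedNonCrossing P M → SignedNonCrossing P' M'
signed-resp P⇔ M⇔ sn = record
  { P-pos = λ p → P-pos (from (P⇔ _ _) p)
  ; M-pos = λ m → M-pos (from (M⇔ _ _) m)
  ; P-sym = λ p → to (P⇔ _ _) (P-sym (from (P⇔ _ _) p))
  ; M-sym = λ m → to (M⇔ _ _) (M-sym (from (M⇔ _ _) m))
  ; PP = λ p q → to (P⇔ _ _) (PP (from (P⇔ _ _) p) (from (P⇔ _ _) q))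
  ; PM = λ p m → to (M⇔ _ _) (PM (from (P⇔ _ _) p) (from (M⇔ _ _) m))
  ; MM = λ m m' → to (P⇔ _ _) (MM (from (M⇔ _ _) m) (from (M⇔ _ _) m'))
  ; crossPP = λ a b c p q → to (P⇔ _ _) (crossPP a b c (from (P⇔ _ _) p) (from (P⇔ _ _) q))
  ; crossPM = λ a b p m → to (P⇔ _ _) (crossPM a b (from (P⇔ _ _) p) (from (M⇔ _ _) m))
  ; crossMM = λ a b m m' → to (P⇔ _ _) (crossMM a b (from (M⇔ _ _) m) (from (M⇔ _ _) m')) }
  where open SignedNonCrossing sn

markSpec-resp : ∀ {P M P' M' : ℕ → ℕ → Set} → (∀ i j → M i j ⇔ M' i j) →
  ∀ x → MarkSpec P M x → MarkSpec P' M' x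
markSpec-resp M⇔ none ms i j m = ms i j (from (M⇔ i j) m)
markSpec-resp M⇔ (edge p q) (p<q , m , gap , nz) =
  p<q , to (M⇔ _ _) m , (λ k l m → gap k l (from (M⇔ _ _) m)) , λ i m → nz i (from (M⇔ _ _) m)
markSpec-resp M⇔ (block B) (z∈ , zeros) =
  z∈ , λ i → mk⇔ (λ i∈ → to (M⇔ i i) (to (zeros i) i∈)) (λ m → from (zeros i) (from (M⇔ i i) m))

spec-resp : ∀ {P M P' M' : ℕ → ℕ → Set} → (∀ i j → P i j ⇔ P' i j) → (∀ i j → M i j ⇔ M' i j) →
  ∀ {y} → Spec P M y → Spec P' M' y
spec-resp {P} {M} {P'} {M'} P⇔ M⇔ {σ , x} (same , ms) =
  (λ i j → mk⇔ (λ s → [ inj₁ ∘ to (P⇔ i j) , inj₂ ∘ to (M⇔ i j) ]′ (to (same i j) s))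
               (λ s → from (same i j) ([ inj₁ ∘ from (P⇔ i j) , inj₂ ∘ from (M⇔ i j) ]′ s)))
  , markSpec-resp {P} {M} {P'} {M'} M⇔ x ms

markSpec-≈ : ∀ {P M : ℕ → ℕ → Set} x y → MarkEq x y → MarkSpec P M y → MarkSpec P M x
markSpec-≈ none none _ ms = ms
markSpec-≈ (edge _ _) (edge _ _) (refl , refl) ms = ms
markSpec-≈ (block B) (block C) B≋C ((z , z∈) , zeros) =
  (z , from (B≋C z) z∈) , λ i → mk⇔ (λ i∈ → to (zeros i) (to (B≋C i) i∈)) (λ m → from (B≋C i) (from (zeros i) m))

spec-≈ : ∀ {P M : ℕ → ℕ → Set} {y y'} → y ≈𝔅 y' → Spec P M y' → Spec P M y
spec-≈ {P} {M} {_ , x} {_ , x'} (σ≈ , x≈) (same , ms) =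
  (λ i j → mk⇔ (λ s → to (same i j) (to (σ≈ i j) s)) (λ s → from (σ≈ i j) (from (same i j) s)))
  , markSpec-≈ {P} {M} x x' x≈ ms

nonCrossing-resp : ∀ {S S' : ℕ → ℕ → Set} → (∀ i j → S i j ⇔ S' i j) → NonCrossing S → NonCrossing S'
nonCrossing-resp S⇔ nc = record
  { S-pos = λ s → S-pos (from (S⇔ _ _) s)
  ; S-sym = λ s → to (S⇔ _ _) (S-sym (from (S⇔ _ _) s))
  ; S-trans = λ s t → to (S⇔ _ _) (S-trans (from (S⇔ _ _) s) (from (S⇔ _ _) t))
  ; cross = λ a b c s t → to (S⇔ _ _) (cross a b c (from (S⇔ _ _) s) (from (S⇔ _ _) t)) }
  where open NonCrossing nc

relValid-resp : ∀ {S S' : ℕ → ℕ → Set} → (∀ i j → S i j ⇔ S' i j) → ∀ x → RelValid S x → RelValid S' x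
relValid-resp S⇔ none _ = tt
relValid-resp S⇔ (edge p q) (s , p<q , gap) =
  to (S⇔ _ _) s , p<q , λ k p<k k<q s → gap k p<k k<q (from (S⇔ _ _) s)
relValid-resp S⇔ (block B) (z∈ , cl) =
  z∈ , λ i j i∈ → mk⇔ (λ s → to (cl i j i∈) (from (S⇔ _ _) s)) (λ j∈ → to (S⇔ _ _) (from (cl i j i∈) j∈))

-- From a marked noncrossing relation to a signed one

same-cases : ∀ θ i j → SameSide θ i j → (i ≤ θ × j ≤ θ) ⊎ (θ < i × θ < j)
same-cases θ i j ss with side θ i | side θ j
... | low i≤ _ | low j≤ _ = inj₁ (i≤ , j≤)
... | high <i _ | high <j _ = inj₂ (<i , <j)
... | low _ e | high _ e' = contradiction (trans (sym e) (trans ss e')) λ ()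
... | high _ e | low _ e' = contradiction (trans (sym e) (trans ss e')) λ ()

opp-cases : ∀ θ i j → OppSide θ i j → (i ≤ θ × θ < j) ⊎ (j ≤ θ × θ < i)
opp-cases θ i j os with side θ i | side θ j
... | low i≤ _ | high <j _ = inj₁ (i≤ , <j)
... | high <i _ | low j≤ _ = inj₂ (j≤ , <i)
... | low _ e | low _ e' = contradiction (trans (sym e) (trans os (cong not e'))) λ ()
... | high _ e | high _ e' = contradiction (trans (sym e) (trans os (cong not e'))) λ ()

same-low : ∀ {θ i j} → i ≤ θ → j ≤ θ → SameSide θ i j
same-low {θ} {i} {j} i≤ j≤ with side θ i | side θ j
... | low _ e | low _ e' = trans e (sym e')
... | high <i _ | _ = contradiction (<-≤-trans <i i≤) (<-irrefl refl)
... | _ | high <j _ = contradiction (<-≤-trans <j j≤) (<-irrefl refl)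

same-high : ∀ {θ i j} → θ < i → θ < j → SameSide θ i j
same-high {θ} {i} {j} <i <j with side θ i | side θ j
... | high _ e | high _ e' = trans e (sym e')
... | low i≤ _ | _ = contradiction (<-≤-trans <i i≤) (<-irrefl refl)
... | _ | low j≤ _ = contradiction (<-≤-trans <j j≤) (<-irrefl refl)

opp-low-high : ∀ {θ i j} → i ≤ θ → θ < j → OppSide θ i j
opp-low-high {θ} {i} {j} i≤ <j with side θ i | side θ j
... | low _ e | high _ e' = trans e (cong not (sym e'))
... | high <i _ | _ = contradiction (<-≤-trans <i i≤) (<-irrefl refl)
... | _ | low j≤ _ = contradiction (<-≤-trans <j j≤) (<-irrefl refl)

not-swap : ∀ {b c} → b ≡ not c → c ≡ not b
not-swap {false} {true} _ = refl
not-swap {true} {false} _ = refl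

module _ {S : ℕ → ℕ → Set} (nc : NonCrossing S) {x : Mark} (valid : RelValid S x) where
  open NonCrossing nc

  private
    θ : ℕ
    θ = threshold x

  -- The threshold is itself used as one of the four points and may coincide with a neighbour;
  -- coinciding points reduce to symmetry and transitivity.
  cross≤ : ∀ {i j k l} → i ≤ j → j ≤ k → k ≤ l → S i k → S j l → S i j
  cross≤ i≤j j≤k k≤l ik jl with m≤n⇒m<n∨m≡n i≤j | m≤n⇒m<n∨m≡n j≤k | m≤n⇒m<n∨m≡n k≤l
  ... | inj₂ refl | _ | _ = S-trans ik (S-sym ik)
  ... | _ | inj₂ refl | _ = ik
  ... | _ | _ | inj₂ refl = S-trans ik (S-sym jl)
  ... | inj₁ i<j | inj₁ j<k | inj₁ k<l = cross i<j j<k k<l ik jl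

  zero-closed : ∀ {i j} → S i j → InZero x i → InZero x j
  zero-closed = go x valid
    where
    go : ∀ x → RelValid S x → ∀ {i j} → S i j → InZero x i → InZero x j
    go (block B) (_ , cl) s i∈ = to (cl _ _ i∈) s

  zero-together : ∀ {i j} → InZero x i → InZero x j → S i j
  zero-together = go x valid
    where
    go : ∀ x → RelValid S x → ∀ {i j} → InZero x i → InZero x j → S i j
    go (block B) (_ , cl) i∈ j∈ = from (cl _ _ i∈) j∈

  zero-threshold : ∀ {i} → InZero x i → S i θ
  zero-threshold iz = zero-together iz (go x iz)
    where
    go : ∀ x {i} → InZero x i → InZero x (threshold x)
    go (block (z ∷ B)) _ = here refl

  zero-opp : ∀ {j l} → OppSide θ j l → (j ≤ θ × θ ≤ l) ⊎ (l ≤ θ × θ ≤ j)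
  zero-opp {j} {l} os with opp-cases θ j l os
  ... | inj₁ (j≤ , <l) = inj₁ (j≤ , <⇒≤ <l)
  ... | inj₂ (l≤ , <j) = inj₂ (l≤ , <⇒≤ <j)

  -- The pairs i, k and j, l are nested here, so noncrossing of S says nothing. Outside the zero
  -- block, opposite signs put θ between j and l, hence between i and k, although these lie on one
  -- side of it. If just one pair lies in the zero block, then so does θ, which supplies a crossing
  -- with the other pair.
  sign-crossPM-inner : ∀ {i j k l} → i < j → j < k → i < l → l < k →
    SignP S x i k → SignM S x j l → S i j
  sign-crossPM-inner i<j j<k i<l l<k (ik , inj₁ iz) (jl , inj₁ jz) = zero-together iz jz
  sign-crossPM-inner i<j j<k i<l l<k (ik , inj₁ iz) (jl , inj₂ os) with zero-opp os
  ... | inj₁ (j≤θ , θ≤l) = S-trans iθ (S-sym (cross≤ j≤θ θ≤l (<⇒≤ l<k) jl (S-trans (S-sym iθ) ik)))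
    where iθ = zero-threshold iz
  ... | inj₂ (l≤θ , θ≤j) = S-trans iθ (S-trans (S-sym (cross≤ l≤θ θ≤j (<⇒≤ j<k) (S-sym jl) (S-trans (S-sym iθ) ik))) (S-sym jl))
    where iθ = zero-threshold iz
  sign-crossPM-inner {i} {j} {k} i<j j<k i<l l<k (ik , inj₂ ss) (jl , inj₁ jz) with same-cases θ i k ss
  ... | inj₁ (_ , k≤θ) = cross≤ (<⇒≤ i<j) (<⇒≤ j<k) k≤θ ik (zero-threshold jz)
  ... | inj₂ (θ<i , _) = S-trans (S-sym (cross≤ (<⇒≤ θ<i) (<⇒≤ i<j) (<⇒≤ j<k) (S-sym jθ) ik)) (S-sym jθ)
    where jθ = zero-threshold jz
  sign-crossPM-inner {i} {j} {k} {l} i<j j<k i<l l<k (ik , inj₂ ss) (jl , inj₂ os) with same-cases θ i k ss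
  ... | inj₁ (_ , k≤θ) = ⊥-elim (¬same×opp θ j l (same-low (≤-trans (<⇒≤ j<k) k≤θ) (≤-trans (<⇒≤ l<k) k≤θ)) os)
  ... | inj₂ (θ<i , _) = ⊥-elim (¬same×opp θ j l (same-high (<-trans θ<i i<j) (<-trans θ<i i<l)) os)

  same-between : ∀ {i j k} → i < j → j < k → SameSide θ i k → SameSide θ i j
  same-between {i} {j} {k} i<j j<k ss with same-cases θ i k ss
  ... | inj₁ (i≤θ , k≤θ) = same-low i≤θ (≤-trans (<⇒≤ j<k) k≤θ)
  ... | inj₂ (θ<i , _) = same-high θ<i (<-trans θ<i i<j)

  sign-crossPP : ∀ {i j k l} → i < j → j < k → k < l → SignP S x i k → SignP S x j l → SignP S x i j
  sign-crossPP i<j j<k k<l (ik , inj₁ iz) (jl , _) = cross i<j j<k k<l ik jl , inj₁ iz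
  sign-crossPP i<j j<k k<l (ik , inj₂ ss) (jl , _) = cross i<j j<k k<l ik jl , inj₂ (same-between i<j j<k ss)

  sign-crossPM : ∀ {i j k l} → i < j → j < k → SignP S x i k → SignM S x j l → SignP S x i j
  sign-crossPM {i} {j} {k} {l} i<j j<k p@(ik , c) m@(jl , _) = ij , [ inj₁ , inj₂ ∘ same-between i<j j<k ]′ c
    where
    ij : S i j
    -- Unless l lies strictly between i and k, the pairs i, k and j, l cross or share an end.
    ij with <-≤-connex l k | <-≤-connex i l
    ... | inj₂ k≤l | _ = cross≤ (<⇒≤ i<j) (<⇒≤ j<k) k≤l ik jl
    ... | inj₁ _ | inj₂ l≤i = S-trans (S-sym (cross≤ l≤i (<⇒≤ i<j) (<⇒≤ j<k) (S-sym jl) ik)) (S-sym jl)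
    ... | inj₁ l<k | inj₁ i<l = sign-crossPM-inner i<j j<k i<l l<k p m

  -- Outside the zero block both pairs straddle θ, and i < j with k < l forces them to do so in the
  -- same direction, so they cross. If one pair is in the zero block, θ serves as a further member
  -- of it.
  sign-crossMM : ∀ {i j k l} → i < j → k < l → SignM S x i k → SignM S x j l → SignP S x i j
  sign-crossMM i<j k<l (ik , inj₁ iz) (jl , inj₁ jz) = zero-together iz jz , inj₁ iz
  sign-crossMM {i} {j} {k} {l} i<j k<l (ik , inj₁ iz) (jl , inj₂ os) = ij , inj₁ iz
    where
    iθ : S i θ
    iθ = zero-threshold iz
    ij : S i j
    ij with zero-opp os
    ... | inj₁ (j≤θ , θ≤l) = cross≤ (<⇒≤ i<j) j≤θ θ≤l iθ jl
    ... | inj₂ (l≤θ , θ≤j) =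
      S-trans ik (S-trans (cross≤ (<⇒≤ k<l) l≤θ θ≤j (S-trans (S-sym ik) iθ) (S-sym jl)) (S-sym jl))
  sign-crossMM {i} {j} {k} {l} i<j k<l (ik , inj₂ os) (jl , inj₁ jz) = ij , inj₁ (zero-closed (S-sym ij) jz)
    where
    jθ : S j θ
    jθ = zero-threshold jz
    ij : S i j
    ij with zero-opp os
    ... | inj₁ (i≤θ , θ≤k) =
      S-trans (cross≤ i≤θ θ≤k (<⇒≤ k<l) ik (S-trans (S-sym jθ) jl)) (S-sym jθ)
    ... | inj₂ (k≤θ , θ≤i) =
      S-trans ik (S-trans (cross≤ k≤θ θ≤i (<⇒≤ i<j) (S-sym ik) (S-sym jθ)) (S-sym jθ))
  sign-crossMM {i} {j} {k} {l} i<j k<l (ik , inj₂ os) (jl , inj₂ os') with opp-cases θ i k os | opp-cases θ j l os'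
  ... | inj₁ (i≤θ , θ<k) | inj₁ (j≤θ , _) =
    cross≤ (<⇒≤ i<j) (≤-trans j≤θ (<⇒≤ θ<k)) (<⇒≤ k<l) ik jl , inj₂ (same-low i≤θ j≤θ)
  ... | inj₁ (_ , θ<k) | inj₂ (l≤θ , _) = contradiction (<-≤-trans (<-trans θ<k k<l) l≤θ) (<-irrefl refl)
  ... | inj₂ (_ , θ<i) | inj₁ (j≤θ , _) = contradiction (<-≤-trans (<-trans θ<i i<j) j≤θ) (<-irrefl refl)
  ... | inj₂ (k≤θ , θ<i) | inj₂ (l≤θ , θ<j) =
    S-trans ik (S-trans (cross≤ (<⇒≤ k<l) (≤-trans l≤θ (<⇒≤ θ<i)) (<⇒≤ i<j) (S-sym ik) (S-sym jl)) (S-sym jl))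
    , inj₂ (same-high θ<i θ<j)

  sign-signedNonCrossing : SignedNonCrossing (SignP S x) (SignM S x)
  sign-signedNonCrossing = record
    { P-pos = S-pos ∘ proj₁
    ; M-pos = S-pos ∘ proj₁
    ; P-sym = λ { (s , c) → S-sym s , [ inj₁ ∘ zero-closed s , inj₂ ∘ sym ]′ c }
    ; M-sym = λ { (s , c) → S-sym s , [ inj₁ ∘ zero-closed s , inj₂ ∘ not-swap ]′ c }
    ; PP = λ { (s , c) (t , d) → S-trans s t , combine s c d trans }
    ; PM = λ { (s , c) (t , d) → S-trans s t , combine s c d trans }
    ; MM = λ { (s , c) (t , d) → S-trans s t , combine s c d (λ e f → trans e (sym (not-swap f))) }
    ; crossPP = sign-crossPP
    ; crossPM = sign-crossPM
    ; crossMM = sign-crossMM }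
    where
    combine : ∀ {i j} {A B C : Set} → S i j → InZero x i ⊎ A → InZero x j ⊎ B → (A → B → C) → InZero x i ⊎ C
    combine s (inj₁ iz) _ f = inj₁ iz
    combine s (inj₂ _) (inj₁ jz) f = inj₁ (zero-closed (S-sym s) jz)
    combine s (inj₂ a) (inj₂ b) f = inj₂ (f a b)

sign-markSpec : ∀ {S} → NonCrossing S → ∀ x → RelValid S x → MarkSpec (SignP S x) (SignM S x) x
sign-markSpec nc none _ i j (s , inj₂ os) with opp-cases 0 i j os
... | inj₁ (i≤0 , _) = contradiction (≤-trans (NonCrossing.S-pos nc s) i≤0) 1+n≰n
... | inj₂ (j≤0 , _) = contradiction (≤-trans (NonCrossing.S-pos nc (NonCrossing.S-sym nc s)) j≤0) 1+n≰n
sign-markSpec {S} nc (edge p q) valid@(pq , p<q , gap) =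
  p<q , (pq , inj₂ (opp-low-high ≤-refl p<q)) , between , λ { i (_ , inj₂ os) → ¬same×opp p i i refl os }
  where
  open NonCrossing nc
  between : ∀ k l → SignM S (edge p q) k l → p < k → k < q → ⊥
  between k l (kl , inj₂ os) p<k k<q with opp-cases p k l os
  ... | inj₁ (k≤p , _) = contradiction (<-≤-trans p<k k≤p) (<-irrefl refl)
  -- From l ≤ p < k < q the pairs l, k and p, q cross or share an end, so k would be an element of
  -- the block of p inside its edge.
  ... | inj₂ (l≤p , _) = gap k p<k k<q
    (S-trans (S-sym (cross≤ nc {edge p q} valid l≤p (<⇒≤ p<k) (<⇒≤ k<q) (S-sym kl) pq)) (S-sym kl))
sign-markSpec nc (block B) (z∈ , cl) = z∈ , λ i →
  mk⇔ (λ i∈ → from (cl i i i∈) i∈ , inj₁ i∈)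
      (λ { (_ , inj₁ i∈) → i∈ ; (_ , inj₂ os) → ⊥-elim (¬same×opp (threshold (block B)) i i refl os) })

sign-spec : ∀ {σ x} → NonCrossing (SameBlock σ) → RelValid (SameBlock σ) x →
  Spec (SignP (SameBlock σ) x) (SignM (SameBlock σ) x) (σ , x)
sign-spec {σ} {x} nc valid =
  (λ i j → mk⇔ (λ s → [ inj₁ ∘ (s ,_) ∘ inj₂ , inj₂ ∘ (s ,_) ∘ inj₂ ]′ (same⊎opp (threshold x) i j))
                [ proj₁ , proj₁ ]′)
  , sign-markSpec nc x valid

-- Partitions and their common-block relations

∃∈ : ∀ {A : Set} {B : List A} → B ≢ [] → ∃[ a ] a ∈ B
∃∈ {B = []} ne = ⊥-elim (ne refl)
∃∈ {B = b ∷ _} _ = b , here refl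

sameBlock-sym : ∀ {A : Set} {P : List (List A)} {a b} → SameBlock P a b → SameBlock P b a
sameBlock-sym s = let B , B∈ , a∈ , b∈ = find s in lose B∈ (b∈ , a∈)

sameBlock : ∀ {A : Set} {P : List (List A)} {B a b} → B ∈ P → a ∈ B → b ∈ B → SameBlock P a b
sameBlock B∈ a∈ b∈ = lose B∈ (a∈ , b∈)

≋-refl : ∀ {A : Set} {B : List A} → B ≋ B
≋-refl a = mk⇔ (λ m → m) (λ m → m)

disjoint⇒≡ : ∀ {A : Set} {P : List (List A)} → AllPairs Disjoint P →
  ∀ {B C a} → B ∈ P → C ∈ P → a ∈ B → a ∈ C → B ≡ C
disjoint⇒≡ dis {a = a} B∈ C∈ a∈B a∈C with ∈-AllPairs₂ dis B∈ C∈
... | inj₁ B≡C = B≡C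
... | inj₂ (inj₁ d) = ⊥-elim (d a a∈B a∈C)
... | inj₂ (inj₂ d) = ⊥-elim (d a a∈C a∈B)

module Partition {A : Set} {S : List A} {P : List (List A)} (part : IsPartitionOf S P) where
  open IsPartitionOf part public

  ∈-closed : ∀ {B a b} → B ∈ P → a ∈ B → SameBlock P a b → b ∈ B
  ∈-closed B∈ a∈ s =
    let C , C∈ , a∈C , b∈C = find s in subst (_ ∈_) (disjoint⇒≡ disjoint C∈ B∈ a∈C a∈) b∈C

  sameBlock-trans : ∀ {a b c} → SameBlock P a b → SameBlock P b c → SameBlock P a c
  sameBlock-trans s t =
    let B , B∈ , a∈ , b∈ = find s in sameBlock B∈ a∈ (∈-closed B∈ b∈ t)

  sameBlock-within : ∀ {a b} → SameBlock P a b → a ∈ S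
  sameBlock-within s = let B , B∈ , a∈ , _ = find s in within _ B B∈ a∈

  sameBlock-refl : ∀ {a} → a ∈ S → SameBlock P a a
  sameBlock-refl a∈S = let B , B∈ , a∈ = find (covers _ a∈S) in sameBlock B∈ a∈ a∈

  ∃∈-block : ∀ {B} → B ∈ P → ∃[ a ] a ∈ B
  ∃∈-block B∈ = ∃∈ (All.lookup nonempty B∈)

∈-[]⁻ : ∀ {n i} → i ∈ [ n ] → 1 ≤ i × i ≤ n
∈-[]⁻ i∈ with ∈-applyUpTo⁻ suc i∈
... | _ , i<n , refl = s≤s z≤n , i<n

∈-[]⁺ : ∀ {n i} → 1 ≤ i → i ≤ n → i ∈ [ n ]
∈-[]⁺ {i = suc i} _ i<n = ∈-applyUpTo⁺ suc i<n

IsEdgeOf : List ℕ → ℕ → ℕ → Set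
IsEdgeOf C i j = (i ∈ C) × (j ∈ C) × (i < j) × (∀ k → k ∈ C → i < k → k < j → ⊥)

-- `IsNC` constrains edges only, whereas crossings are met between arbitrary elements. An element of
-- C strictly between i and k replaces the end on its side of j until none is left; the fuel bounds
-- k - i.
edge-around : ∀ {C j} fuel {i k} → k ≤ i + fuel → ¬ (j ∈ C) → i ∈ C → k ∈ C → i < j → j < k →
  ∃[ e ] ∃[ f ] (IsEdgeOf C e f × i ≤ e × e < j × j < f × f ≤ k)
edge-around zero {i} k≤ j∉ i∈ k∈ i<j j<k =
  contradiction (<-≤-trans (<-trans i<j j<k) (subst (_ ≤_) (+-identityʳ i) k≤)) (<-irrefl refl)
edge-around {C} {j} (suc fuel) {i} {k} k≤ j∉ i∈ k∈ i<j j<k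
  with any? (λ m → (i <? m) ×-dec (m <? k)) C
... | no none-between =
  i , k , (i∈ , k∈ , <-trans i<j j<k , λ m m∈ i<m m<k → none-between (lose m∈ (i<m , m<k)))
  , ≤-refl , i<j , j<k , ≤-refl
... | yes some with find some
... | m , m∈ , i<m , m<k with <-cmp m j
... | tri≈ _ refl _ = contradiction m∈ j∉
... | tri< m<j _ _ =
  let e , f , ef , m≤e , rest = edge-around fuel
        (≤-trans k≤ (≤-trans (≤-reflexive (+-suc i fuel)) (+-monoˡ-≤ fuel i<m))) j∉ m∈ k∈ m<j j<k
  in e , f , ef , ≤-trans (<⇒≤ i<m) m≤e , rest
... | tri> _ _ j<m =
  let e , f , ef , i≤e , e<j , j<f , f≤m = edge-around fuel
        (≤-pred (≤-trans m<k (≤-trans k≤ (≤-reflexive (+-suc i fuel))))) j∉ i∈ m∈ i<j j<m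
  in e , f , ef , i≤e , e<j , j<f , ≤-trans f≤m (<⇒≤ m<k)

-- If j is outside the block C of i and k, some edge (e, f) of C surrounds j. Since j < f < l, some
-- edge (g, h) of the block of j and l surrounds f, and e < j ≤ g < f < h makes the two edges cross.
isNC⇒nonCrossing : ∀ {n σ} → IsNC n σ → NonCrossing (SameBlock σ)
isNC⇒nonCrossing {n} {σ} nc = record
  { S-pos = proj₁ ∘ ∈-[]⁻ ∘ sameBlock-within
  ; S-sym = sameBlock-sym
  ; S-trans = sameBlock-trans
  ; cross = cross }
  where
  open IsNC nc
  open Partition partition
  cross : ∀ {i j k l} → i < j → j < k → k < l → SameBlock σ i k → SameBlock σ j l → SameBlock σ i j
  cross {i} {j} {k} {l} i<j j<k k<l ik jl with find ik | find jl
  ... | C , C∈ , i∈ , k∈ | D , D∈ , j∈ , l∈ with j ∈? C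
  ... | yes j∈C = sameBlock C∈ i∈ j∈C
  ... | no j∉C with edge-around k (m≤n+m k i) j∉C i∈ k∈ i<j j<k
  ... | e , f , ef@(e∈ , f∈ , _) , _ , e<j , j<f , f≤k
    with edge-around l (m≤n+m l j) (λ f∈D → j∉C (subst (j ∈_) (disjoint⇒≡ disjoint D∈ C∈ f∈D f∈) j∈))
           j∈ l∈ j<f (≤-<-trans f≤k k<l)
  ... | g , h , gh , j≤g , g<f , f<h , _ =
    ⊥-elim (noncrossing e f g h (lose C∈ ef) (lose D∈ gh) (<-≤-trans e<j j≤g) g<f f<h)

nonCrossing⇒isNC : ∀ {n σ} → IsPartitionOf [ n ] σ → NonCrossing (SameBlock σ) → IsNC n σ
nonCrossing⇒isNC part nc = record
  { partition = part
  ; noncrossing = λ a b c d ab cd a<c c<b b<d →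
      let B , B∈ , a∈ , b∈ , _ , gap = find ab
          D , D∈ , c∈ , d∈ , _ = find cd
      in gap c (∈-closed B∈ a∈ (cross a<c c<b b<d (sameBlock B∈ a∈ b∈) (sameBlock D∈ c∈ d∈))) a<c c<b }
  where
  open Partition part
  open NonCrossing nc

module _ {S : List ℕ} {σ : List (List ℕ)} (part : IsPartitionOf S σ) where
  open Partition part

  validMark⇒relValid : ∀ x → ValidMark σ x → RelValid (SameBlock σ) x
  validMark⇒relValid none _ = tt
  validMark⇒relValid (edge p q) e =
    let B , B∈ , p∈ , q∈ , p<q , gap = find e
    in sameBlock B∈ p∈ q∈ , p<q , λ k p<k k<q pk → gap k (∈-closed B∈ p∈ pk) p<k k<q
  validMark⇒relValid (block B) v =
    let C , C∈ , B≋C = find v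
        z , z∈ = ∃∈-block C∈
    in (z , from (B≋C z) z∈) , λ i j i∈ →
      mk⇔ (λ ij → from (B≋C j) (∈-closed C∈ (to (B≋C i) i∈) ij))
          (λ j∈ → sameBlock C∈ (to (B≋C i) i∈) (to (B≋C j) j∈))

  relValid⇒validMark : ∀ x → RelValid (SameBlock σ) x → ValidMark σ x
  relValid⇒validMark none _ = tt
  relValid⇒validMark (edge p q) (pq , p<q , gap) =
    let B , B∈ , p∈ , q∈ = find pq
    in lose B∈ (p∈ , q∈ , p<q , λ k k∈ p<k k<q → gap k p<k k<q (sameBlock B∈ p∈ k∈))
  relValid⇒validMark (block B) ((z , z∈) , cl) =
    let C , C∈ , z∈C , _ = find (from (cl z z z∈) z∈)
    in lose C∈ λ i → mk⇔ (λ i∈ → ∈-closed C∈ z∈C (from (cl z i z∈) i∈))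
                         (λ i∈ → to (cl z i z∈) (sameBlock C∈ z∈C i∈))

-- Type B partitions and the sequence 1, ..., n, -1, ..., -n

SameSign OppSign : List (List ℤ) → ℕ → ℕ → Set
SameSign π i j = SameBlock π (+ i) (+ j)
OppSign π i j = SameBlock π (+ i) (ℤ.- (+ j))

a-low : ∀ {n i} → i ≤ n → a n i ≡ + i
a-low {n} {i} i≤n rewrite to T-≡ (≤⇒≤ᵇ i≤n) = refl

a-high : ∀ n {m} → 1 ≤ m → a n (n + m) ≡ ℤ.- (+ m)
a-high n {m} 1≤m with (n + m) ≤ᵇ n in eq
... | true = contradiction (≤-trans (m<m+n n 1≤m) (≤ᵇ⇒≤ _ _ (from T-≡ eq))) (<-irrefl refl)
... | false = cong (λ k → ℤ.- (+ k)) (m+n∸m≡n n m)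

data Position (n : ℕ) : ℕ → Set where
  lo : ∀ {i} → 1 ≤ i → i ≤ n → Position n i
  hi : ∀ {m} → 1 ≤ m → m ≤ n → Position n (n + m)

position : ∀ {n i} → 1 ≤ i → i ≤ n + n → Position n i
position {n} {i} 1≤i i≤2n with i ≤? n
... | yes i≤n = lo 1≤i i≤n
... | no i≰n = subst (Position n) (m+[n∸m]≡n (<⇒≤ n<i)) (hi (m<n⇒0<n∸m n<i) (≤-trans (∸-monoˡ-≤ n i≤2n) (≤-reflexive (m+n∸m≡n n n))))
  where n<i = ≰⇒> i≰n

data Signed (n : ℕ) : ℤ → Set where
  pos : ∀ {m} → 1 ≤ m → m ≤ n → Signed n (+ m)
  neg : ∀ {m} → 1 ≤ m → m ≤ n → Signed n (ℤ.- (+ m))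

∈-[±]⁻ : ∀ {n z} → z ∈ [± n ] → Signed n z
∈-[±]⁻ {n} z∈ with ∈-applyUpTo⁻ (λ i → a n (suc i)) z∈
... | i , i<2n , refl = go (position (s≤s z≤n) i<2n)
  where
  go : ∀ {i} → Position n i → Signed n (a n i)
  go (lo 1≤i i≤n) = subst (Signed n) (sym (a-low i≤n)) (pos 1≤i i≤n)
  go (hi 1≤m m≤n) = subst (Signed n) (sym (a-high n 1≤m)) (neg 1≤m m≤n)

∈-[±]⁺ : ∀ {n z} → Signed n z → z ∈ [± n ]
∈-[±]⁺ {n} (pos {suc m} 1≤m m≤n) =
  subst (_∈ [± n ]) (a-low m≤n) (∈-applyUpTo⁺ (λ i → a n (suc i)) (≤-trans m≤n (m≤m+n n n)))
∈-[±]⁺ {n} (neg {suc m} 1≤m m≤n) =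
  subst (_∈ [± n ]) (trans (cong (a n) (sym (+-suc n m))) (a-high n 1≤m))
    (∈-applyUpTo⁺ (λ i → a n (suc i)) (≤-trans (≤-reflexive (sym (+-suc n m))) (+-monoʳ-≤ n m≤n)))

∈-negB : ∀ {B z} → z ∈ B → (ℤ.- z) ∈ negB B
∈-negB = ∈-map⁺ (ℤ.-_)

∈-negB⁻ : ∀ {B z} → z ∈ negB B → (ℤ.- z) ∈ B
∈-negB⁻ z∈ with ∈-map⁻ (ℤ.-_) z∈
... | w , w∈ , refl = subst (_∈ _) (sym (ℤ.neg-involutive w)) w∈

Symmetric : List (List ℤ) → Set
Symmetric π = ∀ {a b} → SameBlock π a b → SameBlock π (ℤ.- a) (ℤ.- b)

symmetric⇒Symmetric : ∀ {π} → (∀ B → B ∈ π → Any (_≋ negB B) π) → Symmetric π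
symmetric⇒Symmetric symm s =
  let B , B∈ , a∈ , b∈ = find s
      C , C∈ , C≋ = find (symm B B∈)
  in sameBlock C∈ (from (C≋ _) (∈-negB a∈)) (from (C≋ _) (∈-negB b∈))

module _ {n : ℕ} {π : List (List ℤ)} (part : IsPartitionOf [± n ] π) where
  open Partition part

  sameBlock-signed : ∀ {a b} → SameBlock π a b → Signed n a
  sameBlock-signed = ∈-[±]⁻ ∘ sameBlock-within

  +-range : ∀ {i b} → SameBlock π (+ i) b → 1 ≤ i × i ≤ n
  +-range {i} s = go (sameBlock-signed s) refl
    where
    go : ∀ {z} → Signed n z → z ≡ + i → 1 ≤ i × i ≤ n
    go (pos 1≤m m≤n) refl = 1≤m , m≤n
    go (neg {zero} () _) _
    go (neg {suc _} _ _) ()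

module _ {n : ℕ} {π : List (List ℤ)} (part : IsPartitionOf [± n ] π) (symm : Symmetric π) where
  open Partition part

  private
    symm-at : ∀ {a b c d} → ℤ.- a ≡ c → ℤ.- b ≡ d → SameBlock π a b → SameBlock π c d
    symm-at refl refl = symm

  neg-neg : ∀ {i j} → SameBlock π (ℤ.- (+ i)) (ℤ.- (+ j)) → SameSign π i j
  neg-neg = symm-at (ℤ.neg-involutive _) (ℤ.neg-involutive _)

  oppSign-sym : ∀ {i j} → OppSign π i j → OppSign π j i
  oppSign-sym = sameBlock-sym ∘ symm-at refl (ℤ.neg-involutive _)

  oppSign-range : ∀ {i j} → OppSign π i j → 1 ≤ j × j ≤ n
  oppSign-range = +-range {n} part ∘ oppSign-sym

  sameBlock-subst : ∀ {i j i' j'} → i ≡ i' → j ≡ j' → SameBlock π i j → SameBlock π i' j'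
  sameBlock-subst refl refl s = s

  -- A positive i has index i and -j has index n + j. The inequalities absent from the three rules
  -- come from the fact that each index of a positive integer is at most n.
  cross⇒signedNonCrossing : (∀ {i j k l} → 1 ≤ i → i < j → j < k → k < l → l ≤ n + n →
      SameBlock π (a n i) (a n k) → SameBlock π (a n j) (a n l) → SameBlock π (a n i) (a n j)) →
    SignedNonCrossing (SameSign π) (OppSign π)
  cross⇒signedNonCrossing cross = record
    { P-pos = proj₁ ∘ +-range {n} part
    ; M-pos = proj₁ ∘ +-range {n} part
    ; P-sym = sameBlock-sym
    ; M-sym = oppSign-sym
    ; PP = sameBlock-trans
    ; PM = sameBlock-trans
    ; MM = λ m m' → sameBlock-trans m (sameBlock-sym (oppSign-sym m'))
    ; crossPP = crossPP
    ; crossPM = crossPM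
    ; crossMM = crossMM }
    where
    pos-at : ∀ {i b} → SameBlock π (+ i) b → + i ≡ a n i
    pos-at s = sym (a-low (proj₂ (+-range {n} part s)))
    neg-at : ∀ {i j} → OppSign π i j → ℤ.- (+ j) ≡ a n (n + j)
    neg-at s = sym (a-high n (proj₁ (oppSign-range s)))
    crossPP : ∀ {i j k l} → i < j → j < k → k < l → SameSign π i k → SameSign π j l → SameSign π i j
    crossPP i<j j<k k<l ik jl = sameBlock-subst (sym (pos-at ik)) (sym (pos-at jl))
      (cross (proj₁ (+-range {n} part ik)) i<j j<k k<l (≤-trans (proj₂ (+-range {n} part (sameBlock-sym jl))) (m≤m+n n n))
        (sameBlock-subst (pos-at ik) (pos-at (sameBlock-sym ik)) ik) (sameBlock-subst (pos-at jl) (pos-at (sameBlock-sym jl)) jl))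
    crossPM : ∀ {i j k l} → i < j → j < k → SameSign π i k → OppSign π j l → SameSign π i j
    crossPM i<j j<k ik jl = sameBlock-subst (sym (pos-at ik)) (sym (pos-at jl))
      (cross (proj₁ (+-range {n} part ik)) i<j j<k
        (≤-<-trans (proj₂ (+-range {n} part (sameBlock-sym ik))) (m<m+n n (proj₁ (oppSign-range jl))))
        (+-monoʳ-≤ n (proj₂ (oppSign-range jl)))
        (sameBlock-subst (pos-at ik) (pos-at (sameBlock-sym ik)) ik) (sameBlock-subst (pos-at jl) (neg-at jl) jl))
    crossMM : ∀ {i j k l} → i < j → k < l → OppSign π i k → OppSign π j l → SameSign π i j
    crossMM i<j k<l ik jl = sameBlock-subst (sym (pos-at ik)) (sym (pos-at jl))
      (cross (proj₁ (+-range {n} part ik)) i<j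
        (≤-<-trans (proj₂ (+-range {n} part jl)) (m<m+n n (proj₁ (oppSign-range ik))))
        (+-monoʳ-< n k<l) (+-monoʳ-≤ n (proj₂ (oppSign-range jl)))
        (sameBlock-subst (pos-at ik) (neg-at ik) ik) (sameBlock-subst (pos-at jl) (neg-at jl) jl))

  module _ (sn : SignedNonCrossing (SameSign π) (OppSign π)) where
    open SignedNonCrossing sn

    private
      hi<lo : ∀ {m i} {A : Set} → n + m < i → i ≤ n → A
      hi<lo {m} n+m<i i≤n = contradiction (≤-trans (≤-trans n+m<i i≤n) (m≤m+n n m)) (<-irrefl refl)

      cancel : ∀ {m m'} → n + m < n + m' → m < m'
      cancel = +-cancelˡ-< n _ _

    -- With at least two positive entries the pattern is one of the three rules. With one positive
    -- entry, negating the pair j, l and reading k, i backwards gives a case of `crossPM`; with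
    -- none, all four entries are negated.
    signed-cross : ∀ {i j k l} → Position n i → Position n j → Position n k → Position n l →
      i < j → j < k → k < l → SameBlock π (a n i) (a n k) → SameBlock π (a n j) (a n l) →
      SameBlock π (a n i) (a n j)
    signed-cross (hi _ _) (lo _ j≤n) _ _ i<j _ _ _ _ = hi<lo i<j j≤n
    signed-cross _ (hi _ _) (lo _ k≤n) _ _ j<k _ _ _ = hi<lo j<k k≤n
    signed-cross _ _ (hi _ _) (lo _ l≤n) _ _ k<l _ _ = hi<lo k<l l≤n
    signed-cross (lo _ i≤) (lo _ j≤) (lo _ k≤) (lo _ l≤) i<j j<k k<l ik jl =
      sameBlock-subst (sym (a-low i≤)) (sym (a-low j≤))
        (crossPP i<j j<k k<l (sameBlock-subst (a-low i≤) (a-low k≤) ik) (sameBlock-subst (a-low j≤) (a-low l≤) jl))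
    signed-cross (lo _ i≤) (lo _ j≤) (lo _ k≤) (hi 1≤l _) i<j j<k k<l ik jl =
      sameBlock-subst (sym (a-low i≤)) (sym (a-low j≤))
        (crossPM i<j j<k (sameBlock-subst (a-low i≤) (a-low k≤) ik) (sameBlock-subst (a-low j≤) (a-high n 1≤l) jl))
    signed-cross (lo _ i≤) (lo _ j≤) (hi 1≤k _) (hi 1≤l _) i<j j<k k<l ik jl =
      sameBlock-subst (sym (a-low i≤)) (sym (a-low j≤))
        (crossMM i<j (cancel k<l) (sameBlock-subst (a-low i≤) (a-high n 1≤k) ik) (sameBlock-subst (a-low j≤) (a-high n 1≤l) jl))
    signed-cross (lo _ i≤) (hi 1≤j _) (hi 1≤k _) (hi 1≤l _) i<j j<k k<l ik jl =
      sameBlock-subst (sym (a-low i≤)) (sym (a-high n 1≤j)) (MP mik (P-sym pjk))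
      where
      mik = sameBlock-subst (a-low i≤) (a-high n 1≤k) ik
      pjk = crossPM (cancel j<k) (cancel k<l) (neg-neg (sameBlock-subst (a-high n 1≤j) (a-high n 1≤l) jl)) (M-sym mik)
    signed-cross (hi 1≤i _) (hi 1≤j _) (hi 1≤k _) (hi 1≤l _) i<j j<k k<l ik jl =
      sameBlock-subst (sym (a-high n 1≤i)) (sym (a-high n 1≤j)) (symm
        (crossPP (cancel i<j) (cancel j<k) (cancel k<l)
          (neg-neg (sameBlock-subst (a-high n 1≤i) (a-high n 1≤k) ik)) (neg-neg (sameBlock-subst (a-high n 1≤j) (a-high n 1≤l) jl))))

    zeroBlock-witness : ∀ {B} → B ∈ π → B ≋ negB B → ∃[ i ] (+ i) ∈ B × OppSign π i i
    zeroBlock-witness {B} B∈ B≋ = go (∈-[±]⁻ (within _ B B∈ (proj₂ b))) (proj₂ b)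
      where
      b = ∃∈-block B∈
      neg∈ : ∀ {z} → z ∈ B → (ℤ.- z) ∈ B
      neg∈ z∈ = ∈-negB⁻ (to (B≋ _) z∈)
      go : ∀ {z} → Signed n z → z ∈ B → ∃[ i ] (+ i) ∈ B × OppSign π i i
      go (pos {m} _ _) z∈ = m , z∈ , sameBlock B∈ z∈ (neg∈ z∈)
      go (neg {m} _ _) z∈ = m , +m∈ , sameBlock B∈ +m∈ z∈
        where +m∈ = subst (_∈ B) (ℤ.neg-involutive (+ m)) (neg∈ z∈)

    zero-sameSign : ∀ {i j} → OppSign π i i → OppSign π j j → SameSign π i j
    zero-sameSign {i} {j} ii jj with <-cmp i j
    ... | tri< i<j _ _ = crossMM i<j i<j ii jj
    ... | tri≈ _ refl _ = M-refl ii
    ... | tri> _ _ j<i = P-sym (crossMM j<i j<i jj ii)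

    signed⇒isNCB : (∀ B → B ∈ π → Any (_≋ negB B) π) → IsNCB n π
    signed⇒isNCB symmetric = record
      { partition = part
      ; symmetric = symmetric
      -- Two zero blocks contain i, -i and j, -j respectively; these pairs alternate unless i = j,
      -- so the blocks coincide.
      ; atMostOneZeroBlock = λ B C B∈ C∈ B≋ C≋ →
          let i , i∈ , ii = zeroBlock-witness B∈ B≋
              j , j∈ , jj = zeroBlock-witness C∈ C≋
          in disjoint⇒≡ disjoint B∈ C∈ (∈-closed B∈ i∈ (zero-sameSign ii jj)) j∈
      ; noncrossing = λ B B' i j k l B∈ B'∈ B≢B' 1≤i i<j j<k k<l l≤2n i∈ k∈ j∈ l∈ →
          let k≤2n = ≤-trans (<⇒≤ k<l) l≤2n
              j≤2n = ≤-trans (<⇒≤ j<k) k≤2n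
              1≤j = ≤-trans 1≤i (<⇒≤ i<j)
              1≤k = ≤-trans 1≤j (<⇒≤ j<k)
              ij = signed-cross (position 1≤i (≤-trans (<⇒≤ i<j) j≤2n)) (position 1≤j j≤2n)
                     (position 1≤k k≤2n) (position (≤-trans 1≤k (<⇒≤ k<l)) l≤2n) i<j j<k k<l
                     (sameBlock B∈ i∈ k∈) (sameBlock B'∈ j∈ l∈)
          in B≢B' (disjoint⇒≡ disjoint B∈ B'∈ (∈-closed B∈ i∈ ij) j∈) }

isNCB⇒signedNonCrossing : ∀ {n π} → IsNCB n π → SignedNonCrossing (SameSign π) (OppSign π)
isNCB⇒signedNonCrossing {n} {π} ncb = cross⇒signedNonCrossing partition (symmetric⇒Symmetric symmetric) cross
  where
  open IsNCB ncb
  cross : ∀ {i j k l} → 1 ≤ i → i < j → j < k → k < l → l ≤ n + n →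
    SameBlock π (a n i) (a n k) → SameBlock π (a n j) (a n l) → SameBlock π (a n i) (a n j)
  cross 1≤i i<j j<k k<l l≤2n ik jl with find ik | find jl
  ... | B , B∈ , i∈ , k∈ | B' , B'∈ , j∈ , l∈ with ≡-dec ℤ._≟_ B B'
  ... | yes refl = sameBlock B∈ i∈ j∈
  ... | no B≢B' = ⊥-elim (noncrossing B B' _ _ _ _ B∈ B'∈ B≢B' 1≤i i<j j<k k<l l≤2n i∈ k∈ j∈ l∈)

≈ₚ-signed : ∀ {n π π'} → IsPartitionOf [± n ] π → Symmetric π → Symmetric π' →
  (∀ i j → SameSign π i j → SameSign π' i j) → (∀ i j → OppSign π i j → OppSign π' i j) →
  ∀ {a b} → SameBlock π a b → SameBlock π' a b
≈ₚ-signed {n} {π} {π'} part symm symm' P→ M→ {a} {b} s =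
  go (sameBlock-signed part s) (sameBlock-signed part (sameBlock-sym s)) s
  where
  go : ∀ {a b} → Signed n a → Signed n b → SameBlock π a b → SameBlock π' a b
  go (pos _ _) (pos _ _) s = P→ _ _ s
  go (pos _ _) (neg _ _) s = M→ _ _ s
  go (neg _ _) (pos _ _) s = sameBlock-sym (M→ _ _ (sameBlock-sym s))
  go (neg _ _) (neg _ _) s = symm' (P→ _ _ (neg-neg {n} part symm s))

-- Lists of blocks, sorting and pairing

module _ {A : Set} (_≟_ : (x y : A) → Dec (x ≡ y)) where

  T-mem : ∀ {x B} → T (any (λ y → does (x ≟ y)) B) ⇔ (x ∈ B)
  T-mem {x} {B} = mk⇔ (λ t → Any.map toWit (any⁻ _ B t)) (λ x∈ → any⁺ _ (Any.map fromWit x∈))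
    where
    toWit : ∀ {y} → T (does (x ≟ y)) → x ≡ y
    toWit {y} t with yes p ← x ≟ y = p
    fromWit : ∀ {y} → x ≡ y → T (does (x ≟ y))
    fromWit {y} p with x ≟ y
    ... | yes _ = _
    ... | no ¬p = ¬p p

  T-sub : ∀ {B C} → T (all (λ x → any (λ y → does (x ≟ y)) C) B) ⇔ (∀ x → x ∈ B → x ∈ C)
  T-sub {B} {C} = mk⇔ (λ t x x∈ → to T-mem (All.lookup (all⁺ _ B t) x∈))
                      (λ f → all⁻ _ (All.tabulate (λ x∈ → from T-mem (f _ x∈))))

  T-setEq : ∀ {B C} → T (all (λ x → any (λ y → does (x ≟ y)) C) B ∧ all (λ x → any (λ y → does (x ≟ y)) B) C) ⇔ (B ≋ C)
  T-setEq {B} {C} = mk⇔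
    (λ t x → let s , s' = to T-∧ t in mk⇔ (to T-sub s x) (to T-sub s' x))
    (λ e → from T-∧ (from T-sub (λ x → to (e x)) , from T-sub (λ x → from (e x))))

T-setEqℕ : ∀ {B C} → T (setEqℕ B C) ⇔ (B ≋ C)
T-setEqℕ = T-setEq ℕ._≟_

T-setEqℤ : ∀ {B C} → T (setEqℤ B C) ⇔ (B ≋ C)
T-setEqℤ = T-setEq ℤ._≟_

T-not⁺ : ∀ {b} → ¬ T b → T (not b)
T-not⁺ {false} _ = _
T-not⁺ {true} ¬t = ¬t _

T-not⁻ : ∀ {b} → T (not b) → ¬ T b
T-not⁻ {false} _ ()

T-ext : ∀ {b c} → T b ⇔ T c → b ≡ c
T-ext {true} {true} _ = refl
T-ext {false} {false} _ = refl
T-ext {true} {false} e = ⊥-elim (to e _)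
T-ext {false} {true} e = ⊥-elim (from e _)

filterᵇ-split : ∀ {A : Set} {p q : A → Bool} xs → (∀ {x} → x ∈ xs → q x ≡ not (p x)) →
  filterᵇ p xs ++ filterᵇ q xs ↭ xs
filterᵇ-split [] _ = ↭-refl
filterᵇ-split {p = p} {q} (x ∷ xs) h with p x | q x | h (here refl)
... | true | false | refl = prep x (filterᵇ-split xs (h ∘ there))
... | false | true | refl =
  ↭-trans (shift x (filterᵇ p xs) (filterᵇ q xs)) (prep x (filterᵇ-split xs (h ∘ there)))

allPairs-++⁻ : ∀ {A : Set} {R : A → A → Set} xs {ys x y} → AllPairs R (xs ++ ys) → x ∈ xs → y ∈ ys → R x y
allPairs-++⁻ (x ∷ xs) (r ∷ _) (here refl) y∈ = All.lookup r (∈-++⁺ʳ xs y∈)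
allPairs-++⁻ (x ∷ xs) (_ ∷ rs) (there x∈) y∈ = allPairs-++⁻ xs rs x∈ y∈

allPairs-reverse : ∀ {A : Set} {R : A → A → Set} xs → AllPairs R xs → AllPairs (λ x y → R y x) (reverse xs)
allPairs-reverse [] _ = []
allPairs-reverse {R = R} (x ∷ xs) (r ∷ rs) =
  subst (AllPairs _) (sym (unfold-reverse x xs)) (snoc (allPairs-reverse xs rs)
    (All.tabulate (λ y∈ → All.lookup r (∈-resp-↭ (↭-reverse xs) y∈))))
  where
  snoc : ∀ {ys} → AllPairs (λ x y → R y x) ys → All (R x) ys → AllPairs (λ x y → R y x) (ys ++ x ∷ [])
  snoc [] [] = [] ∷ []
  snoc {y ∷ ys} (s ∷ ss) (t ∷ ts) = All.tabulate (λ z∈ → elem (∈-++⁻ ys z∈)) ∷ snoc ss ts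
    where
    elem : ∀ {z} → z ∈ ys ⊎ z ∈ x ∷ [] → R z y
    elem (inj₁ z∈) = All.lookup s z∈
    elem (inj₂ (here refl)) = t

-- A monotone bijective matching of two strictly sorted lists can only match entries in order: the
-- heads must be matched to each other, and then the tails inherit all hypotheses.
monotone⇒pointwise : ∀ {A B : Set} {R : A → B → Set} {_<₁_ : A → A → Set} {_<₂_ : B → B → Set} →
  (∀ {y y'} → y <₂ y' → ¬ (y' <₂ y)) → ∀ {xs ys} → AllPairs _<₁_ xs → AllPairs _<₂_ ys →
  (∀ {x} → x ∈ xs → ∃[ y ] y ∈ ys × R x y) → (∀ {y} → y ∈ ys → ∃[ x ] x ∈ xs × R x y) →
  (∀ {x y y'} → x ∈ xs → y ∈ ys → y' ∈ ys → R x y → R x y' → ¬ (y <₂ y')) →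
  (∀ {x x' y y'} → x ∈ xs → x' ∈ xs → y ∈ ys → y' ∈ ys → R x y → R x' y' → x <₁ x' → y <₂ y') →
  Pointwise R xs ys
monotone⇒pointwise asym {[]} {[]} _ _ _ _ _ _ = []
monotone⇒pointwise asym {[]} {y ∷ ys} _ _ _ right _ _ with right (here refl)
... | _ , () , _
monotone⇒pointwise asym {x ∷ xs} {[]} _ _ left _ _ _ with left (here refl)
... | _ , () , _
monotone⇒pointwise {R = R} asym {x ∷ xs} {y ∷ ys} (x< ∷ s) (y< ∷ s') left right func mono =
  xRy ∷ monotone⇒pointwise asym s s' left' right'
    (λ x∈ y∈ y'∈ → func (there x∈) (there y∈) (there y'∈))
    (λ x∈ x'∈ y∈ y'∈ → mono (there x∈) (there x'∈) (there y∈) (there y'∈))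
  where
  xRy : R x y
  xRy with left (here refl) | right (here refl)
  ... | _ , here refl , r | _ = r
  ... | _ | _ , here refl , r = r
  -- If both heads were matched into the tails, monotonicity would place y' before the head y.
  ... | y' , there y'∈ , r | x' , there x'∈ , r' =
    ⊥-elim (asym (All.lookup y< y'∈)
      (mono (here refl) (there x'∈) (there y'∈) (here refl) r r' (All.lookup x< x'∈)))
  left' : ∀ {x'} → x' ∈ xs → ∃[ y' ] y' ∈ ys × R x' y'
  left' x'∈ with left (there x'∈)
  ... | y' , there y'∈ , r = y' , y'∈ , r
  ... | _ , here refl , r = ⊥-elim (asym y<y y<y)
    where y<y = mono (here refl) (there x'∈) (here refl) (here refl) xRy r (All.lookup x< x'∈)
  right' : ∀ {y'} → y' ∈ ys → ∃[ x' ] x' ∈ xs × R x' y'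
  right' y'∈ with right (there y'∈)
  ... | x' , there x'∈ , r = x' , x'∈ , r
  ... | _ , here refl , r = ⊥-elim (func (here refl) (here refl) (there y'∈) xRy r (All.lookup y< y'∈))

pointwise-++⁻ : ∀ {A B : Set} {R : A → B → Set} {xs ys xs' ys'} → length xs ≡ length ys →
  Pointwise R (xs ++ xs') (ys ++ ys') → Pointwise R xs ys × Pointwise R xs' ys'
pointwise-++⁻ {xs = []} {[]} _ rs = [] , rs
pointwise-++⁻ {xs = _ ∷ _} {_ ∷ _} eq (r ∷ rs) =
  let ps , qs = pointwise-++⁻ (suc-injective eq) rs in r ∷ ps , qs

module _ {A : Set} {R : List A → List A → Set} where

  zipWith-++-left : ∀ {xs ys} → Pointwise R xs ys → ∀ {x} → x ∈ xs →
    ∃[ y ] y ∈ ys × R x y × (x ++ y) ∈ zipWith _++_ xs ys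
  zipWith-++-left (r ∷ _) (here refl) = _ , here refl , r , here refl
  zipWith-++-left (_ ∷ rs) (there x∈) =
    let y , y∈ , r , z∈ = zipWith-++-left rs x∈ in y , there y∈ , r , there z∈

  zipWith-++-right : ∀ {xs ys} → Pointwise R xs ys → ∀ {y} → y ∈ ys →
    ∃[ x ] x ∈ xs × R x y × (x ++ y) ∈ zipWith _++_ xs ys
  zipWith-++-right (r ∷ _) (here refl) = _ , here refl , r , here refl
  zipWith-++-right (_ ∷ rs) (there y∈) =
    let x , x∈ , r , z∈ = zipWith-++-right rs y∈ in x , there x∈ , r , there z∈

  zipWith-++⁻ : ∀ {xs ys} → Pointwise R xs ys → ∀ {z} → z ∈ zipWith _++_ xs ys →
    ∃[ x ] ∃[ y ] x ∈ xs × y ∈ ys × R x y × z ≡ x ++ y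
  zipWith-++⁻ (r ∷ _) (here refl) = _ , _ , here refl , here refl , r , refl
  zipWith-++⁻ (_ ∷ rs) (there z∈) =
    let x , y , x∈ , y∈ , r , e = zipWith-++⁻ rs z∈ in x , y , there x∈ , there y∈ , r , e

split : ∀ {A : Set} t s (xs : List A) → length xs ≡ t + s →
  ∃[ ys ] ∃[ zs ] xs ≡ ys ++ zs × length ys ≡ t × length zs ≡ s
split zero s xs eq = [] , xs , refl , refl , eq
split (suc t) s (x ∷ xs) eq =
  let ys , zs , e , l , r = split t s xs (suc-injective eq) in x ∷ ys , zs , cong (x ∷_) e , cong suc l , r

take-++ : ∀ {A : Set} (xs : List A) {ys t} → length xs ≡ t → take t (xs ++ ys) ≡ xs
take-++ [] refl = refl
take-++ (x ∷ xs) refl = cong (x ∷_) (take-++ xs refl)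

nth-++ : ∀ xs {y ys t} → length xs ≡ t → nth (xs ++ y ∷ ys) t ≡ y
nth-++ [] refl = refl
nth-++ (x ∷ xs) refl = nth-++ xs refl

nth-++-suc : ∀ xs {y z ys t} → length xs ≡ t → nth (xs ++ y ∷ z ∷ ys) (suc t) ≡ z
nth-++-suc [] refl = refl
nth-++-suc (x ∷ xs) refl = nth-++-suc xs refl

data Halved : ℕ → Set where
  even : ∀ t → Halved (t * 2)
  odd  : ∀ t → Halved (1 + t * 2)

halve : ∀ k → Halved k
halve zero = even 0
halve (suc k) with halve k
... | even t = odd t
... | odd t = even (suc t)

half-odd : ∀ t → (1 + t * 2) / 2 ≡ t
half-odd t = trans (+-distrib-/-∣ʳ 1 (n∣m*n t {2})) (m*n/n≡m t 2)

maxL-≥ : ∀ {A x} → x ∈ A → x ≤ maxL A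
maxL-≥ {y ∷ A} (here refl) = m≤m⊔n y (maxL A)
maxL-≥ {y ∷ A} (there x∈) = ≤-trans (maxL-≥ x∈) (m≤n⊔m y (maxL A))

maxL-∈ : ∀ {A} → A ≢ [] → maxL A ∈ A
maxL-∈ {[]} ne = ⊥-elim (ne refl)
maxL-∈ {x ∷ A} _ with foldr-selective ⊔-sel 0 (x ∷ A)
... | inj₂ m∈ = m∈
-- The fold starts from 0. A maximum of 0 forces the head to be 0, so it is attained there.
... | inj₁ m≡0 = here (trans m≡0 (sym (n≤0⇒n≡0 (subst (x ≤_) m≡0 (maxL-≥ {x ∷ A} (here refl))))))

foldr-⊓-≤ : ∀ e A {x} → x ≡ e ⊎ x ∈ A → foldr _⊓_ e A ≤ x
foldr-⊓-≤ e [] (inj₁ refl) = ≤-refl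
foldr-⊓-≤ e (y ∷ A) (inj₂ (here refl)) = m⊓n≤m y (foldr _⊓_ e A)
foldr-⊓-≤ e (y ∷ A) (inj₁ refl) = ≤-trans (m⊓n≤n y (foldr _⊓_ e A)) (foldr-⊓-≤ e A (inj₁ refl))
foldr-⊓-≤ e (y ∷ A) (inj₂ (there x∈)) = ≤-trans (m⊓n≤n y (foldr _⊓_ e A)) (foldr-⊓-≤ e A (inj₂ x∈))

minL-≤ : ∀ {A x} → x ∈ A → minL A ≤ x
minL-≤ {y ∷ A} (here refl) = foldr-⊓-≤ y A (inj₁ refl)
minL-≤ {y ∷ A} (there x∈) = foldr-⊓-≤ y A (inj₂ x∈)

minL-∈ : ∀ {A} → A ≢ [] → minL A ∈ A
minL-∈ {[]} ne = ⊥-elim (ne refl)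
minL-∈ {x ∷ A} _ with foldr-selective ⊓-sel x A
... | inj₁ m≡x = here m≡x
... | inj₂ m∈ = there m∈

_<ₘ_ : List ℕ → List ℕ → Set
A <ₘ C = maxL A < maxL C

insertByMax-↭ : ∀ A Cs → insertByMax A Cs ↭ A ∷ Cs
insertByMax-↭ A [] = ↭-refl
insertByMax-↭ A (C ∷ Cs) with maxL A ≤ᵇ maxL C
... | true = ↭-refl
... | false = ↭-trans (prep C (insertByMax-↭ A Cs)) (swap C A ↭-refl)

sortByMax-↭ : ∀ Cs → sortByMax Cs ↭ Cs
sortByMax-↭ [] = ↭-refl
sortByMax-↭ (C ∷ Cs) = ↭-trans (insertByMax-↭ C (sortByMax Cs)) (prep C (sortByMax-↭ Cs))

insertByMax-sorted : ∀ A Cs → All (λ C → maxL A ≢ maxL C) Cs → AllPairs _<ₘ_ Cs →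
  AllPairs _<ₘ_ (insertByMax A Cs)
insertByMax-sorted A [] _ _ = [] ∷ []
insertByMax-sorted A (C ∷ Cs) (ne ∷ nes) (C< ∷ s) with maxL A ≤ᵇ maxL C in eq
... | true = (A<C ∷ All.map (<-trans A<C) C<) ∷ C< ∷ s
  where A<C = ≤∧≢⇒< (≤ᵇ⇒≤ (maxL A) (maxL C) (from T-≡ eq)) ne
... | false = All-resp-↭ (↭-sym (insertByMax-↭ A Cs)) (C<A ∷ C<) ∷ insertByMax-sorted A Cs nes s
  where C<A = ≰⇒> λ le → contradiction (trans (sym eq) (to T-≡ (≤⇒≤ᵇ le))) λ ()

sortByMax-sorted : ∀ {Cs} → AllPairs (λ A C → maxL A ≢ maxL C) Cs → AllPairs _<ₘ_ (sortByMax Cs)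
sortByMax-sorted [] = []
sortByMax-sorted {C ∷ Cs} (ne ∷ nes) =
  insertByMax-sorted C (sortByMax Cs) (All-resp-↭ (↭-sym (sortByMax-↭ Cs)) ne) (sortByMax-sorted nes)

-- Merging blocks of a partition

disjoint-sym : ∀ {A : Set} {B C : List A} → Disjoint B C → Disjoint C B
disjoint-sym d a a∈C a∈B = d a a∈B a∈C

allPairs-resp-↭ : ∀ {A : Set} {R : A → A → Set} → (∀ {x y} → R x y → R y x) →
  ∀ {xs ys} → xs ↭ ys → AllPairs R xs → AllPairs R ys
allPairs-resp-↭ {A} {R} symR xs↭ys = ↭ₛ.AllPairs-resp-↭ (setoid A) symR (resp₂ R) (↭⇒↭ₛ xs↭ys)

isPartitionOf-↭ : ∀ {A : Set} {S : List A} {P Q} → P ↭ Q → IsPartitionOf S P → IsPartitionOf S Q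
isPartitionOf-↭ P↭Q part = record
  { nonempty = All-resp-↭ P↭Q nonempty
  ; blocksAreSets = All-resp-↭ P↭Q blocksAreSets
  ; disjoint = allPairs-resp-↭ disjoint-sym P↭Q disjoint
  ; covers = λ a a∈ → Any-resp-↭ P↭Q (covers a a∈)
  ; within = λ a B B∈ → within a B (∈-resp-↭ (↭-sym P↭Q) B∈) }
  where open IsPartitionOf part

isPartitionOf-merge : ∀ {A : Set} {S : List A} {B C P} → IsPartitionOf S (B ∷ C ∷ P) → IsPartitionOf S ((B ++ C) ∷ P)
isPartitionOf-merge {S = S} {B} {C} {P} part with part
... | record { nonempty = B≢[] ∷ _ ∷ ne ; blocksAreSets = uB ∷ uC ∷ us ; disjoint = (dBC ∷ dB) ∷ dC ∷ ds
             ; covers = covers ; within = within } = record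
  { nonempty = ++-nonempty B≢[] ∷ ne
  ; blocksAreSets = Unique.++⁺ uB uC (λ { (b∈ , c∈) → dBC _ b∈ c∈ }) ∷ us
  ; disjoint = All.tabulate (λ D∈ a a∈ a∈D → [ (λ a∈B → All.lookup dB D∈ a a∈B a∈D)
                                             , (λ a∈C → All.lookup dC D∈ a a∈C a∈D) ]′ (∈-++⁻ B a∈)) ∷ ds
  ; covers = λ a a∈ → cover (covers a a∈)
  ; within = λ
    { a D (here refl) a∈ → [ within a B (here refl) , within a C (there (here refl)) ]′ (∈-++⁻ B a∈)
    ; a D (there D∈) a∈ → within a D (there (there D∈)) a∈ } }
  where
  ++-nonempty : B ≢ [] → B ++ C ≢ []
  ++-nonempty ne e with ∃∈ ne
  ... | _ , b∈ with subst (_ ∈_) e (∈-++⁺ˡ b∈)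
  ... | ()
  cover : ∀ {a} → Any (a ∈_) (B ∷ C ∷ P) → Any (a ∈_) ((B ++ C) ∷ P)
  cover (here a∈) = here (∈-++⁺ˡ a∈)
  cover (there (here a∈)) = here (∈-++⁺ʳ B a∈)
  cover (there (there a∈)) = there a∈

isPartitionOf-zipWith : ∀ {A : Set} {S : List A} L R {P} → length L ≡ length R →
  IsPartitionOf S (L ++ R ++ P) → IsPartitionOf S (zipWith _++_ L R ++ P)
isPartitionOf-zipWith [] [] _ part = part
isPartitionOf-zipWith (B ∷ L) (C ∷ R) {P} eq part =
  isPartitionOf-↭ (shift (B ++ C) (zipWith _++_ L R) P)
    (isPartitionOf-zipWith L R (suc-injective eq)
      (isPartitionOf-↭ (↭-sym (insert (B ++ C)))
        (isPartitionOf-merge (isPartitionOf-↭ (prep B (shift C L (R ++ P))) part))))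
  where
  insert : ∀ D → L ++ R ++ D ∷ P ↭ D ∷ L ++ R ++ P
  insert D = ↭-trans (++⁺ˡ L (shift D R P)) (shift D L (R ++ P))

-- The body of `φB` with length, quotient, remainder and reversed list as parameters, so that the
-- arithmetic can be rewritten once the parity is known.
φB-output : List (List ℕ) → List (List ℕ) → (k t r : ℕ) → List (List ℕ) → List (List ℕ) × Mark
φB-output rest As k t r Rs =
  (rest ++ zipWith _++_ (take t As) (take t Rs) ++ (if r ≡ᵇ 1 then nth As t ∷ [] else []))
  , (if k ≡ᵇ 0 then none
     else if r ≡ᵇ 0 then edge (maxL (nth As (t ∸ 1))) (minL (nth As t))
     else block (nth As t))

unmatched : List (List ℕ) → List (List ℕ) → List (List ℕ)
unmatched X = filterᵇ (λ C → not (any (setEqℕ C) X))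

φB-even : ∀ rest As {t} → length As ≡ t * 2 →
  φB-output rest As (length As) (length As / 2) (length As % 2) (reverse As) ≡
  φB-output rest As (t * 2) t 0 (reverse As)
φB-even rest As {t} eq rewrite eq | m*n/n≡m t 2 {{_}} | m*n%n≡0 t 2 {{_}} = refl

φB-odd : ∀ rest As {t} → length As ≡ 1 + t * 2 →
  φB-output rest As (length As) (length As / 2) (length As % 2) (reverse As) ≡
  φB-output rest As (1 + t * 2) t 1 (reverse As)
φB-odd rest As {t} eq rewrite eq | half-odd t | [m+kn]%n≡m%n 1 t 2 {{_}} = refl

output-edge : ∀ rest {As Rs L R A C t} → take (suc t) As ≡ L → take (suc t) Rs ≡ R →
  nth As t ≡ A → nth As (suc t) ≡ C →
  φB-output rest As (suc t * 2) (suc t) 0 Rs ≡ (rest ++ zipWith _++_ L R ++ [] , edge (maxL A) (minL C))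
output-edge rest refl refl refl refl = refl

output-block : ∀ rest {As Rs L R B t} → take t As ≡ L → take t Rs ≡ R → nth As t ≡ B →
  φB-output rest As (1 + t * 2) t 1 Rs ≡ (rest ++ zipWith _++_ L R ++ B ∷ [] , block B)
output-block rest refl refl refl = refl

length≡0 : ∀ {A : Set} (xs : List A) → length xs ≡ 0 → xs ≡ []
length≡0 [] _ = refl

allPairs-map-∈ : ∀ {A : Set} {R S : A → A → Set} {xs} → (∀ {x y} → x ∈ xs → y ∈ xs → R x y → S x y) →
  AllPairs R xs → AllPairs S xs
allPairs-map-∈ f [] = []
allPairs-map-∈ f (r ∷ rs) =
  All.tabulate (λ y∈ → f (here refl) (there y∈) (All.lookup r y∈))
  ∷ allPairs-map-∈ (λ x∈ y∈ → f (there x∈) (there y∈)) rs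

-- Pairing and merging the mixed blocks

module Merge {P M : ℕ → ℕ → Set} (sn : SignedNonCrossing P M)
  {n : ℕ} {σ : List (List ℕ)} (part : IsPartitionOf [ n ] σ)
  (σ⇔P : ∀ i j → SameBlock σ i j ⇔ P i j)
  (mixed : List ℕ → Bool)
  (mixed⇔ : ∀ {C} → C ∈ σ → T (mixed C) ⇔ (∃[ i ] ∃[ j ] i ∈ C × M i j))
  where

  open SignedNonCrossing sn
  open Partition part

  X As rest : List (List ℕ)
  X = filterᵇ mixed σ
  As = sortByMax X
  rest = unmatched X σ

  in-P : ∀ {C i j} → C ∈ σ → i ∈ C → j ∈ C → P i j
  in-P C∈ i∈ j∈ = to (σ⇔P _ _) (sameBlock C∈ i∈ j∈)

  P-closed : ∀ {C i j} → C ∈ σ → i ∈ C → P i j → j ∈ C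
  P-closed C∈ i∈ p = ∈-closed C∈ i∈ (from (σ⇔P _ _) p)

  P⇒≡ : ∀ {A C i j} → A ∈ σ → C ∈ σ → i ∈ A → j ∈ C → P i j → A ≡ C
  P⇒≡ A∈ C∈ i∈ j∈ p = disjoint⇒≡ disjoint A∈ C∈ (P-closed A∈ i∈ p) j∈

  block-of : ∀ {i j} → P i j → ∃[ C ] C ∈ σ × i ∈ C
  block-of p = let C , C∈ , i∈ , _ = find (from (σ⇔P _ _) p) in C , C∈ , i∈

  -- `rest` drops the blocks that are equal as sets to some member of X. Nonempty disjoint blocks
  -- that are equal as sets are equal as lists, so these are precisely the mixed ones.
  X++rest↭σ : X ++ rest ↭ σ
  X++rest↭σ = filterᵇ-split σ (λ {C} C∈ → cong not (T-ext (mk⇔ (fwd C∈) (bwd C∈))))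
    where
    fwd : ∀ {C} → C ∈ σ → T (any (setEqℕ C) X) → T (mixed C)
    fwd {C} C∈ t with find (any⁻ (setEqℕ C) X t)
    ... | C' , C'∈X , eq with ∈-filter⁻ (T? ∘ mixed) {xs = σ} C'∈X
    ... | C'∈ , mC' with ∃∈-block C∈
    ... | i , i∈ = subst (T ∘ mixed) (disjoint⇒≡ disjoint C'∈ C∈ (to (to T-setEqℕ eq i) i∈) i∈) mC'
    bwd : ∀ {C} → C ∈ σ → T (mixed C) → T (any (setEqℕ C) X)
    bwd {C} C∈ m = any⁺ (setEqℕ C) (lose (∈-filter⁺ (T? ∘ mixed) C∈ m) (from (T-setEqℕ {C}) ≋-refl))

  ∈As⁻ : ∀ {A} → A ∈ As → A ∈ σ × ∃[ i ] ∃[ j ] i ∈ A × M i j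
  ∈As⁻ A∈As =
    let A∈ , m = ∈-filter⁻ (T? ∘ mixed) {xs = σ} (∈-resp-↭ (sortByMax-↭ X) A∈As)
    in A∈ , to (mixed⇔ A∈) m

  ∈As⇒σ : ∀ {A} → A ∈ As → A ∈ σ
  ∈As⇒σ = proj₁ ∘ ∈As⁻

  ∈As⁺ : ∀ {A i j} → A ∈ σ → i ∈ A → M i j → A ∈ As
  ∈As⁺ A∈ i∈ m = ∈-resp-↭ (↭-sym (sortByMax-↭ X))
    (∈-filter⁺ (T? ∘ mixed) A∈ (from (mixed⇔ A∈) (_ , _ , i∈ , m)))

  max∈ : ∀ {A} → A ∈ As → maxL A ∈ A
  max∈ A∈ = maxL-∈ (All.lookup nonempty (∈As⇒σ A∈))

  min∈ : ∀ {A} → A ∈ As → minL A ∈ A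
  min∈ A∈ = minL-∈ (All.lookup nonempty (∈As⇒σ A∈))

  sorted : AllPairs _<ₘ_ As
  sorted = sortByMax-sorted (allPairs-map-∈ distinct (AllPairs.filter⁺ (T? ∘ mixed) disjoint))
    where
    distinct : ∀ {A C} → A ∈ X → C ∈ X → Disjoint A C → maxL A ≢ maxL C
    distinct A∈ C∈ d eq = d _ (maxX A∈) (subst (_∈ _) (sym eq) (maxX C∈))
      where
      maxX : ∀ {A} → A ∈ X → maxL A ∈ A
      maxX A∈ = maxL-∈ (All.lookup nonempty (proj₁ (∈-filter⁻ (T? ∘ mixed) {xs = σ} A∈)))

  <ₘ⇒≢ : ∀ {A C} → A <ₘ C → A ≢ C
  <ₘ⇒≢ lt refl = <-irrefl refl lt

  -- Mixed blocks are not nested, so ordering them by maxima separates them.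
  <ₘ⇒< : ∀ {A C i j} → A ∈ As → C ∈ As → A <ₘ C → i ∈ A → j ∈ C → i < j
  <ₘ⇒< {A} {C} {i} {j} A∈ C∈ A<C i∈ j∈ with <-cmp (maxL A) j
  ... | tri< lt _ _ = ≤-<-trans (maxL-≥ i∈) lt
  ... | tri≈ _ eq _ =
    ⊥-elim (<ₘ⇒≢ A<C (disjoint⇒≡ disjoint (∈As⇒σ A∈) (∈As⇒σ C∈) (max∈ A∈) (subst (_∈ C) (sym eq) j∈)))
  ... | tri> _ _ gt =
    let Aσ , i₀ , x , i₀∈ , m = ∈As⁻ A∈
        p = crossPM gt A<C (in-P (∈As⇒σ C∈) j∈ (max∈ C∈)) (PM (in-P Aσ (max∈ A∈) i₀∈) m)
    in ⊥-elim (<ₘ⇒≢ A<C (sym (P⇒≡ (∈As⇒σ C∈) Aσ j∈ (max∈ A∈) p)))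

  Paired : List ℕ → List ℕ → Set
  Paired A C = ∀ {i j} → i ∈ A → j ∈ C → M i j

  pair : ∀ {A C i j} → A ∈ σ → C ∈ σ → i ∈ A → j ∈ C → M i j → Paired A C
  pair A∈ C∈ i∈ j∈ m i'∈ j'∈ = MP (PM (in-P A∈ i'∈ i∈) m) (in-P C∈ j∈ j'∈)

  -- If i and -j share a block, then so do j and -i; hence the block of j is mixed as well.
  partner : ∀ {A} → A ∈ As → ∃[ C ] C ∈ As × Paired A C
  partner A∈ =
    let Aσ , i , j , i∈ , m = ∈As⁻ A∈
        C , C∈ , j∈ = block-of (M-refl (M-sym m))
    in C , ∈As⁺ C∈ j∈ (M-sym m) , pair Aσ C∈ i∈ j∈ m

  partner-unique : ∀ {A C C'} → A ∈ As → C ∈ As → C' ∈ As → Paired A C → Paired A C' → C ≡ C'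
  partner-unique A∈ C∈ C'∈ ac ac' = P⇒≡ (∈As⇒σ C∈) (∈As⇒σ C'∈) (max∈ C∈) (max∈ C'∈)
    (MM (M-sym (ac (max∈ A∈) (max∈ C∈))) (ac' (max∈ A∈) (max∈ C'∈)))

  -- If the maxima of C and C' were in the same order as those of A and A', `crossMM` would identify
  -- A with A'.
  paired-antitone : ∀ {A A' C C'} → A ∈ As → A' ∈ As → C ∈ As → C' ∈ As →
    Paired A C → Paired A' C' → A <ₘ A' → C' <ₘ C
  paired-antitone {A} {A'} {C} {C'} A∈ A'∈ C∈ C'∈ ac a'c' A<A' with <-cmp (maxL C) (maxL C')
  ... | tri> _ _ gt = gt
  ... | tri< lt _ _ = ⊥-elim (<ₘ⇒≢ A<A' (P⇒≡ (∈As⇒σ A∈) (∈As⇒σ A'∈) (max∈ A∈) (max∈ A'∈)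
    (crossMM A<A' lt (ac (max∈ A∈) (max∈ C∈)) (a'c' (max∈ A'∈) (max∈ C'∈)))))
  ... | tri≈ _ eq _ = ⊥-elim (<ₘ⇒≢ A<A' (P⇒≡ (∈As⇒σ A∈) (∈As⇒σ A'∈) (max∈ A∈) (max∈ A'∈)
    (MM (ac (max∈ A∈) (max∈ C∈)) (M-sym (subst (M (maxL A')) (sym eq) (a'c' (max∈ A'∈) (max∈ C'∈)))))))

  ∈-reverse⁻ : ∀ {A} → A ∈ reverse As → A ∈ As
  ∈-reverse⁻ = ∈-resp-↭ (↭-reverse As)

  ∈-reverse⁺ : ∀ {A} → A ∈ As → A ∈ reverse As
  ∈-reverse⁺ = ∈-resp-↭ (↭-sym (↭-reverse As))

  -- Against the reversed list the order-reversing pairing is monotone, so `monotone⇒pointwise`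
  -- applies.
  paired-reverse : Pointwise Paired As (reverse As)
  paired-reverse = monotone⇒pointwise <-asym sorted (allPairs-reverse As sorted)
    (λ A∈ → let C , C∈ , ac = partner A∈ in C , ∈-reverse⁺ C∈ , ac)
    (λ C∈ → let A , A∈ , ca = partner (∈-reverse⁻ C∈) in A , A∈ , λ i∈ j∈ → M-sym (ca j∈ i∈))
    (λ A∈ C∈ C'∈ ac ac' C'<C → <ₘ⇒≢ C'<C (sym (partner-unique A∈ (∈-reverse⁻ C∈) (∈-reverse⁻ C'∈) ac ac')))
    (λ A∈ A'∈ C∈ C'∈ → paired-antitone A∈ A'∈ (∈-reverse⁻ C∈) (∈-reverse⁻ C'∈))

  -- Both parities are treated together: `mid` is empty or consists of the middle block, which is
  -- its own partner.
  module _ {L R mid : List (List ℕ)} (As↭ : As ↭ L ++ R ++ mid) (LR : Pointwise Paired L R)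
           (midmid : ∀ {C} → C ∈ mid → Paired C C) where

    private
      merged = zipWith _++_ L R

      σ↭ : σ ↭ L ++ R ++ mid ++ rest
      σ↭ = ↭-trans (↭-sym X++rest↭σ) (↭-trans (++⁺ʳ rest (↭-trans (↭-sym (sortByMax-↭ X)) As↭))
        (↭-reflexive (trans (++-assoc L (R ++ mid) rest) (cong (L ++_) (++-assoc R mid rest)))))

      ∈L : ∀ {C} → C ∈ L → C ∈ As
      ∈L C∈ = ∈-resp-↭ (↭-sym As↭) (∈-++⁺ˡ C∈)

      ∈R : ∀ {C} → C ∈ R → C ∈ As
      ∈R C∈ = ∈-resp-↭ (↭-sym As↭) (∈-++⁺ʳ L (∈-++⁺ˡ C∈))

      ∈mid : ∀ {C} → C ∈ mid → C ∈ As
      ∈mid C∈ = ∈-resp-↭ (↭-sym As↭) (∈-++⁺ʳ L (∈-++⁺ʳ R C∈))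

    merged-partition : length L ≡ length R → IsPartitionOf [ n ] (rest ++ merged ++ mid)
    merged-partition eq = isPartitionOf-↭
      (↭-trans (↭-reflexive (sym (++-assoc merged mid rest))) (++-comm (merged ++ mid) rest))
      (isPartitionOf-zipWith L R eq (isPartitionOf-↭ σ↭ part))

    merged-sameBlock : ∀ i j → SameBlock (rest ++ merged ++ mid) i j ⇔ (P i j ⊎ M i j)
    merged-sameBlock i j = mk⇔ fwd [ bwdP , bwdM ]′
      where
      rest⇒σ : ∀ {C} → C ∈ rest → C ∈ σ
      rest⇒σ C∈ = ∈-resp-↭ X++rest↭σ (∈-++⁺ʳ X C∈)

      in-merged : ∀ {C} → C ∈ merged → i ∈ C → j ∈ C → P i j ⊎ M i j
      in-merged C∈ i∈ j∈ with zipWith-++⁻ LR C∈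
      ... | A , D , A∈ , D∈ , ad , refl with ∈-++⁻ A i∈ | ∈-++⁻ A j∈
      ... | inj₁ i∈A | inj₁ j∈A = inj₁ (in-P (∈As⇒σ (∈L A∈)) i∈A j∈A)
      ... | inj₁ i∈A | inj₂ j∈D = inj₂ (ad i∈A j∈D)
      ... | inj₂ i∈D | inj₁ j∈A = inj₂ (M-sym (ad j∈A i∈D))
      ... | inj₂ i∈D | inj₂ j∈D = inj₁ (in-P (∈As⇒σ (∈R D∈)) i∈D j∈D)

      fwd : SameBlock (rest ++ merged ++ mid) i j → P i j ⊎ M i j
      fwd s with find s
      ... | C , C∈ , i∈ , j∈ with ∈-++⁻ rest C∈
      ... | inj₁ C∈rest = inj₁ (in-P (rest⇒σ C∈rest) i∈ j∈)
      ... | inj₂ C∈' with ∈-++⁻ merged C∈'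
      ... | inj₁ C∈merged = in-merged C∈merged i∈ j∈
      ... | inj₂ C∈mid = inj₁ (in-P (∈As⇒σ (∈mid C∈mid)) i∈ j∈)

      in-rest : ∀ {C} → C ∈ rest → i ∈ C → j ∈ C → SameBlock (rest ++ merged ++ mid) i j
      in-rest C∈ = sameBlock (∈-++⁺ˡ C∈)

      in-zip : ∀ {C} → C ∈ merged → i ∈ C → j ∈ C → SameBlock (rest ++ merged ++ mid) i j
      in-zip C∈ = sameBlock (∈-++⁺ʳ rest (∈-++⁺ˡ C∈))

      in-mid : ∀ {C} → C ∈ mid → i ∈ C → j ∈ C → SameBlock (rest ++ merged ++ mid) i j
      in-mid C∈ = sameBlock (∈-++⁺ʳ rest (∈-++⁺ʳ merged C∈))

      bwdP : P i j → SameBlock (rest ++ merged ++ mid) i j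
      bwdP p with find (from (σ⇔P i j) p)
      ... | C , C∈ , i∈ , j∈ with ∈-++⁻ L (∈-resp-↭ σ↭ C∈)
      ... | inj₁ C∈L = let D , _ , _ , CD∈ = zipWith-++-left LR C∈L in in-zip CD∈ (∈-++⁺ˡ i∈) (∈-++⁺ˡ j∈)
      ... | inj₂ C∈' with ∈-++⁻ R C∈'
      ... | inj₁ C∈R = let A , _ , _ , AC∈ = zipWith-++-right LR C∈R in in-zip AC∈ (∈-++⁺ʳ A i∈) (∈-++⁺ʳ A j∈)
      ... | inj₂ C∈'' with ∈-++⁻ mid C∈''
      ... | inj₁ C∈mid = in-mid C∈mid i∈ j∈
      ... | inj₂ C∈rest = in-rest C∈rest i∈ j∈

      bwdM : M i j → SameBlock (rest ++ merged ++ mid) i j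
      bwdM m with block-of (M-refl m)
      ... | A , A∈ , i∈ with ∈-++⁻ L (∈-resp-↭ As↭ (∈As⁺ A∈ i∈ m))
      ... | inj₁ A∈L =
        let C , C∈ , ac , AC∈ = zipWith-++-left LR A∈L
            c∈ = max∈ (∈R C∈)
            j∈ = P-closed (∈As⇒σ (∈R C∈)) c∈ (MM (M-sym (ac i∈ c∈)) m)
        in in-zip AC∈ (∈-++⁺ˡ i∈) (∈-++⁺ʳ A j∈)
      ... | inj₂ A∈' with ∈-++⁻ R A∈'
      ... | inj₁ A∈R =
        let C , C∈ , ca , CA∈ = zipWith-++-right LR A∈R
            c∈ = max∈ (∈L C∈)
            j∈ = P-closed (∈As⇒σ (∈L C∈)) c∈ (MM (ca c∈ i∈) m)
        in in-zip CA∈ (∈-++⁺ʳ C i∈) (∈-++⁺ˡ j∈)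
      ... | inj₂ A∈mid = in-mid A∈mid i∈ (P-closed A∈ i∈ (MM (midmid A∈mid i∈ i∈) m))

    -- A block of L never equals its partner in R, so only blocks of mid are self-paired.
    self-paired : (∀ {A C} → A ∈ L → C ∈ R → A <ₘ C) → ∀ {A i} → A ∈ As → i ∈ A → M i i → A ∈ mid
    self-paired L<R {A} {i} A∈ i∈ m with ∈-++⁻ L (∈-resp-↭ As↭ A∈)
    ... | inj₁ A∈L =
      let C , C∈ , ac , _ = zipWith-++-left LR A∈L
      in ⊥-elim (<ₘ⇒≢ (L<R A∈L C∈)
           (partner-unique A∈ A∈ (∈R C∈) (pair (∈As⇒σ A∈) (∈As⇒σ A∈) i∈ i∈ m) ac))
    ... | inj₂ A∈' with ∈-++⁻ R A∈'
    ... | inj₂ A∈mid = A∈mid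
    ... | inj₁ A∈R =
      let C , C∈ , ca , _ = zipWith-++-right LR A∈R
      in ⊥-elim (<ₘ⇒≢ (L<R C∈ A∈R)
           (partner-unique A∈ (∈L C∈) A∈ (λ i∈ j∈ → M-sym (ca j∈ i∈)) (pair (∈As⇒σ A∈) (∈As⇒σ A∈) i∈ i∈ m)))

  private
    Correct : List (List ℕ) × Mark → Set
    Correct y = IsPartitionOf [ n ] (proj₁ y) × Spec P M y

    -- Reversing L ++ mid ++ D turns D into the first segment and keeps `mid` in the middle, so the
    -- pointwise pairing with the reversed list splits along these segments.
    pointwise-halves : ∀ {L mid D} → As ≡ L ++ mid ++ D → length L ≡ length D →
      Pointwise Paired L (reverse D) × Pointwise Paired mid (reverse mid)
    pointwise-halves {L} {mid} {D} eq lens =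
      let LR , rs = pointwise-++⁻ (trans lens (sym (length-reverse D))) paired
          mm , _ = pointwise-++⁻ (sym (length-reverse mid)) rs
      in LR , mm
      where
      reverse-As : reverse As ≡ reverse D ++ reverse mid ++ reverse L
      reverse-As = trans (cong reverse eq) (trans (reverse-++ L (mid ++ D))
        (trans (cong (_++ reverse L) (reverse-++ mid D)) (++-assoc (reverse D) (reverse mid) (reverse L))))
      paired : Pointwise Paired (L ++ mid ++ D) (reverse D ++ reverse mid ++ reverse L)
      paired = subst (λ xs → Pointwise Paired xs _) eq (subst (Pointwise Paired As) reverse-As paired-reverse)

    take-reverse : ∀ {L D t} → As ≡ L ++ D → length D ≡ t → take t (reverse As) ≡ reverse D
    take-reverse {L} {D} {t} eq lD = trans (cong (take t ∘ reverse) eq)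
      (trans (cong (take t) (reverse-++ L D)) (take-++ (reverse D) (trans (length-reverse D) lD)))

    sorted-++ : ∀ L {D A C} → As ≡ L ++ D → A ∈ L → C ∈ D → A <ₘ C
    sorted-++ L eq = allPairs-++⁻ L (subst (AllPairs _<ₘ_) eq sorted)

    As↭halves : ∀ {L D} mid → As ≡ L ++ mid ++ D → As ↭ L ++ reverse D ++ mid
    As↭halves {L} {D} mid eq = ↭-trans (↭-reflexive eq)
      (++⁺ˡ L (↭-trans (++-comm mid D) (++⁺ʳ mid (↭-sym (↭-reverse D)))))

    ∈-of : ∀ {L D A} → As ≡ L ++ A ∷ D → A ∈ As
    ∈-of {L} eq = subst (_ ∈_) (sym eq) (∈-++⁺ʳ L (here refl))

    M-block : ∀ {i j} → M i j → ∃[ A ] A ∈ As × i ∈ A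
    M-block m = let A , A∈ , i∈ = block-of (M-refl m) in A , ∈As⁺ A∈ i∈ m , i∈

    correct-none : length As ≡ 0 → Correct (φB-output rest As 0 0 0 (reverse As))
    correct-none eq = merged-partition {[]} {[]} {[]} As↭ [] (λ ()) refl
      , merged-sameBlock {[]} {[]} {[]} As↭ [] (λ ())
      , λ i j m → empty (proj₁ (proj₂ (M-block m)))
      where
      As≡ : As ≡ []
      As≡ = length≡0 As eq
      As↭ : As ↭ []
      As↭ = ↭-reflexive As≡
      empty : ∀ {A} → A ∈ As → ⊥
      empty A∈ = ∉[] (subst (_ ∈_) As≡ A∈)

    correct-edge : ∀ {L A C D} → As ≡ L ++ A ∷ C ∷ D → length L ≡ length D →
      Correct (rest ++ zipWith _++_ (L ++ A ∷ []) (reverse (C ∷ D)) ++ [] , edge (maxL A) (minL C))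
    correct-edge {L} {A} {C} {D} eq lens =
      merged-partition {mid = []} As↭ LR (λ ()) (trans lens' (sym (length-reverse (C ∷ D))))
      , merged-sameBlock {mid = []} As↭ LR (λ ())
      , <ₘ⇒< A∈ C∈ A<C (max∈ A∈) (min∈ C∈) , AC (max∈ A∈) (min∈ C∈) , gap , λ i m →
          let B , B∈ , i∈ = M-block m
          in ∉[] (self-paired {mid = []} As↭ LR (λ ())
                   (λ E∈ F∈ → sorted-++ (L ++ A ∷ []) eq' E∈ (∈-resp-↭ (↭-reverse (C ∷ D)) F∈)) B∈ i∈ m)
      where
      eq' : As ≡ (L ++ A ∷ []) ++ C ∷ D
      eq' = trans eq (sym (++-assoc L (A ∷ []) (C ∷ D)))
      lens' : length (L ++ A ∷ []) ≡ length (C ∷ D)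
      lens' = trans (length-++ L) (trans (+-comm (length L) 1) (cong suc lens))
      As↭ : As ↭ (L ++ A ∷ []) ++ reverse (C ∷ D) ++ []
      As↭ = As↭halves {L ++ A ∷ []} {C ∷ D} [] eq'
      LR : Pointwise Paired (L ++ A ∷ []) (reverse (C ∷ D))
      LR = proj₁ (pointwise-halves {mid = []} eq' lens')
      A∈ = ∈-of {L} eq
      C∈ = ∈-of {L ++ A ∷ []} eq'
      A<C = sorted-++ (L ++ A ∷ []) eq' (∈-++⁺ʳ L (here refl)) (here refl)
      -- C is the last entry of `reverse (C ∷ D)` and therefore faces A, the last entry of the lower
      -- half.
      AC : Paired A C
      AC with proj₂ (pointwise-++⁻ {xs = L} {reverse D} {A ∷ []} {C ∷ []} (trans lens (sym (length-reverse D)))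
                (subst (Pointwise Paired (L ++ A ∷ [])) (unfold-reverse C D) LR))
      ... | ac ∷ [] = ac
      -- A mixed element lies in some block of `As`. By separation, A and the blocks of L end no
      -- later than `maxL A`, while C and the blocks of D start no earlier than `minL C`.
      gap : ∀ k l → M k l → maxL A < k → k < minL C → ⊥
      gap k l m p<k k<q with M-block m
      ... | E , E∈ , k∈ with ∈-++⁻ L (subst (E ∈_) eq E∈)
      ... | inj₁ E∈L = <-asym p<k (<ₘ⇒< E∈ A∈ (sorted-++ L eq E∈L (here refl)) k∈ (max∈ A∈))
      ... | inj₂ (here refl) = <⇒≱ p<k (maxL-≥ k∈)
      ... | inj₂ (there (here refl)) = <⇒≱ k<q (minL-≤ k∈)
      ... | inj₂ (there (there E∈D)) = <-asym k<q (<ₘ⇒< C∈ E∈ C<E (min∈ C∈) k∈)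
        where
        C<E = sorted-++ ((L ++ A ∷ []) ++ C ∷ []) (trans eq' (sym (++-assoc (L ++ A ∷ []) (C ∷ []) D)))
                (∈-++⁺ʳ (L ++ A ∷ []) (here refl)) E∈D

    correct-block : ∀ {L m D} → As ≡ L ++ m ∷ D → length L ≡ length D →
      Correct (rest ++ zipWith _++_ L (reverse D) ++ m ∷ [] , block m)
    correct-block {L} {m} {D} eq lens =
      merged-partition {mid = m ∷ []} As↭ LR midmid (trans lens (sym (length-reverse D)))
      , merged-sameBlock {mid = m ∷ []} As↭ LR midmid
      , (maxL m , max∈ m∈) , λ i → mk⇔ (λ i∈ → mm i∈ i∈) bwd
      where
      m∈ = ∈-of {L} eq
      As↭ : As ↭ L ++ reverse D ++ m ∷ []
      As↭ = As↭halves {L} {D} (m ∷ []) eq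
      halves = pointwise-halves {L} {m ∷ []} eq lens
      LR = proj₁ halves
      mm : Paired m m
      mm with proj₂ halves
      ... | r ∷ [] = r
      midmid : ∀ {C} → C ∈ m ∷ [] → Paired C C
      midmid (here refl) = mm
      bwd : ∀ {i} → M i i → i ∈ m
      bwd mi with M-block mi
      ... | E , E∈ , i∈ with self-paired As↭ LR midmid
             (λ A∈ C∈ → sorted-++ L eq A∈ (there (∈-resp-↭ (↭-reverse D) C∈))) E∈ i∈ mi
      ... | here refl = i∈

  φB-correct : Correct (φB (σ , X))
  φB-correct = go refl (halve (length As))
    where
    double : ∀ t → t * 2 ≡ t + t
    double t = trans (*-comm t 2) (cong (λ s → t + s) (+-identityʳ t))
    go : ∀ {k} → length As ≡ k → Halved k → Correct (φB (σ , X))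
    go eq (even zero) = subst Correct (sym (φB-even rest As {0} eq)) (correct-none eq)
    -- The length is t + (2 + t), which exposes the two middle blocks at indices t and t + 1; for
    -- half-length t + 1 these are the two entries that `φB` looks up.
    go eq (even (suc t)) with split t (2 + t) As
      (trans eq (trans (cong (λ s → 2 + s) (double t)) (sym (trans (+-suc t (suc t)) (cong suc (+-suc t t))))))
    ... | L , A ∷ C ∷ D , As≡ , lL , lD = subst Correct
      (sym (trans (φB-even rest As {suc t} eq) (output-edge rest
        (trans (cong (take (suc t)) As≡') (take-++ (L ++ A ∷ []) (trans (length-++ L) (trans (+-comm _ 1) (cong suc lL)))))
        (take-reverse {L ++ A ∷ []} As≡' (suc-injective lD))
        (trans (cong (λ xs → nth xs t) As≡) (nth-++ L lL))
        (trans (cong (λ xs → nth xs (suc t)) As≡) (nth-++-suc L lL)))))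
      (correct-edge As≡ (trans lL (sym (suc-injective (suc-injective lD)))))
      where As≡' = trans As≡ (sym (++-assoc L (A ∷ []) (C ∷ D)))
    go eq (odd t) with split t (suc t) As (trans eq (trans (cong suc (double t)) (sym (+-suc t t))))
    ... | L , m ∷ D , As≡ , lL , lD = subst Correct
      (sym (trans (φB-odd rest As {t} eq) (output-block rest
        (trans (cong (take t) As≡) (take-++ L lL))
        (take-reverse {L ++ m ∷ []} (trans As≡ (sym (++-assoc L (m ∷ []) D))) (suc-injective lD))
        (trans (cong (λ xs → nth xs t) As≡) (nth-++ L lL)))))
      (correct-block As≡ (trans lL (sym (suc-injective lD))))

-- The positive part of a type B partition

∈-posPart⁺ : ∀ {B i} → 1 ≤ i → (+ i) ∈ B → i ∈ posPart B
∈-posPart⁺ {i = suc _} _ (here refl) = here refl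
∈-posPart⁺ {+ suc k ∷ B} 1≤i (there i∈) = there (∈-posPart⁺ 1≤i i∈)
∈-posPart⁺ {+ zero ∷ B} 1≤i (there i∈) = ∈-posPart⁺ {B} 1≤i i∈
∈-posPart⁺ { -[1+ k ] ∷ B} 1≤i (there i∈) = ∈-posPart⁺ {B} 1≤i i∈

∈-posPart⁻ : ∀ B {i} → i ∈ posPart B → (+ i) ∈ B
∈-posPart⁻ (+ suc k ∷ B) (here refl) = here refl
∈-posPart⁻ (+ suc k ∷ B) (there i∈) = there (∈-posPart⁻ B i∈)
∈-posPart⁻ (+ zero ∷ B) i∈ = there (∈-posPart⁻ B i∈)
∈-posPart⁻ (-[1+ k ] ∷ B) i∈ = there (∈-posPart⁻ B i∈)

posPart-unique : ∀ {B} → Unique B → Unique (posPart B)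
posPart-unique {[]} _ = []
posPart-unique {+ suc k ∷ B} (k∉ ∷ u) =
  All.tabulate (λ i∈ eq → All.lookup k∉ (∈-posPart⁻ B i∈) (cong +_ eq)) ∷ posPart-unique u
posPart-unique {+ zero ∷ B} (_ ∷ u) = posPart-unique {B} u
posPart-unique { -[1+ k ] ∷ B} (_ ∷ u) = posPart-unique {B} u

positiveBlocks : List (List ℤ) → List (List ℕ)
positiveBlocks π = filterᵇ nonEmptyᵇ (map posPart π)

mixedᵇ : List (List ℤ) → List ℕ → Bool
mixedᵇ π C = any (properSubᵇ C) π

T-nonEmpty : ∀ {A : Set} {B : List A} → T (nonEmptyᵇ B) ⇔ (B ≢ [])
T-nonEmpty {B = []} = mk⇔ (λ ()) (λ ne → ne refl)
T-nonEmpty {B = _ ∷ _} = mk⇔ (λ _ ()) (λ _ → _)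

∈⇒≢[] : ∀ {A : Set} {B : List A} {a} → a ∈ B → B ≢ []
∈⇒≢[] a∈ refl = ∉[] a∈

module _ {n : ℕ} {π : List (List ℤ)} (ncb : IsNCB n π) where
  open IsNCB ncb using (symmetric) renaming (partition to part)
  open Partition part

  private
    σ = positiveBlocks π
    symm = symmetric⇒Symmetric symmetric

    ∈σ⁻ : ∀ {C} → C ∈ σ → C ≢ [] × ∃[ B ] B ∈ π × C ≡ posPart B
    ∈σ⁻ C∈ =
      let C∈' , ne = ∈-filter⁻ (T? ∘ nonEmptyᵇ) {xs = map posPart π} C∈
          B , B∈ , eq = ∈-map⁻ posPart C∈'
      in to T-nonEmpty ne , B , B∈ , eq

    ∈σ⁺ : ∀ {B i} → B ∈ π → i ∈ posPart B → posPart B ∈ σ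
    ∈σ⁺ B∈ i∈ = ∈-filter⁺ (T? ∘ nonEmptyᵇ) (∈-map⁺ posPart B∈) (from T-nonEmpty (∈⇒≢[] i∈))

  positiveBlocks-partition : IsPartitionOf [ n ] σ
  positiveBlocks-partition = record
    { nonempty = All.tabulate (proj₁ ∘ ∈σ⁻)
    ; blocksAreSets = All.tabulate λ C∈ →
        let _ , B , B∈ , eq = ∈σ⁻ C∈
        in subst Unique (sym eq) (posPart-unique (All.lookup blocksAreSets B∈))
    ; disjoint = AllPairs.filter⁺ (T? ∘ nonEmptyᵇ) (AllPairs.map⁺ (AllPairs.map
        (λ {B} {C} d i i∈B i∈C → d (+ i) (∈-posPart⁻ B i∈B) (∈-posPart⁻ C i∈C)) disjoint))
    ; covers = λ i i∈ →
        let 1≤i , i≤n = ∈-[]⁻ i∈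
            B , B∈ , +i∈ = find (covers (+ i) (∈-[±]⁺ (pos 1≤i i≤n)))
            i∈B = ∈-posPart⁺ 1≤i +i∈
        in lose (∈σ⁺ B∈ i∈B) i∈B
    ; within = λ i C C∈ i∈ →
        let _ , B , B∈ , eq = ∈σ⁻ C∈
            +i∈ = ∈-posPart⁻ B (subst (i ∈_) eq i∈)
            1≤i , i≤n = +-range {n} part (sameBlock B∈ +i∈ +i∈)
        in ∈-[]⁺ 1≤i i≤n }

  positiveBlocks-sameBlock : ∀ i j → SameBlock σ i j ⇔ SameSign π i j
  positiveBlocks-sameBlock i j = mk⇔ fwd bwd
    where
    fwd : SameBlock σ i j → SameSign π i j
    fwd s with find s
    ... | C , C∈ , i∈ , j∈ with ∈σ⁻ C∈
    ... | _ , B , B∈ , refl = sameBlock B∈ (∈-posPart⁻ B i∈) (∈-posPart⁻ B j∈)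
    bwd : SameSign π i j → SameBlock σ i j
    bwd s =
      let B , B∈ , i∈ , j∈ = find s
          i∈' = ∈-posPart⁺ (proj₁ (+-range {n} part s)) i∈
          j∈' = ∈-posPart⁺ (proj₁ (+-range {n} part (sameBlock-sym s))) j∈
      in sameBlock (∈σ⁺ B∈ i∈') i∈' j∈'

  -- All positive elements of the block of π around C already lie in C, so the inclusion is proper
  -- exactly when that block has a negative element.
  mixedᵇ⇔ : ∀ {C} → C ∈ σ → T (mixedᵇ π C) ⇔ (∃[ i ] ∃[ j ] i ∈ C × OppSign π i j)
  mixedᵇ⇔ {C} C∈ = mk⇔ fwd (λ { (_ , _ , i∈ , m) → bwd i∈ m })
    where
    module σ = Partition positiveBlocks-partition

    fwd : T (mixedᵇ π C) → ∃[ i ] ∃[ j ] i ∈ C × OppSign π i j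
    fwd t with find (any⁻ (properSubᵇ C) π t)
    ... | B , B∈ , sub with to T-∧ sub
    ... | C⊆B , B⊈C with σ.∃∈-block C∈
                        | find (¬All⇒Any¬ (λ b → T? (memℤ b (map +_ C))) B (T-not⁻ B⊈C ∘ all⁻ _))
    ... | i , i∈ | b , b∈ , b∉ = classify (∈-[±]⁻ {n} (within b B B∈ b∈)) b∈ (b∉ ∘ from (T-mem ℤ._≟_))
      where
      +i∈ = to (T-sub ℤ._≟_) C⊆B (+ i) (∈-map⁺ +_ i∈)
      classify : ∀ {b} → Signed n b → b ∈ B → ¬ (b ∈ map +_ C) → ∃[ i ] ∃[ j ] i ∈ C × OppSign π i j
      classify (neg {m} _ _) b∈ _ = i , m , i∈ , sameBlock B∈ +i∈ b∈
      classify (pos {m} _ _) b∈ b∉ = ⊥-elim (b∉ (∈-map⁺ +_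
        (σ.∈-closed C∈ i∈ (from (positiveBlocks-sameBlock i m) (sameBlock B∈ +i∈ b∈)))))

    bwd : ∀ {i j} → i ∈ C → OppSign π i j → T (mixedᵇ π C)
    bwd {i} {j} i∈ m with find m
    ... | B , B∈ , +i∈ , -j∈ = any⁺ (properSubᵇ C) (lose B∈ (from T-∧
      (from (T-sub ℤ._≟_) C⊆B , T-not⁺ λ t → negative∉ (proj₁ (oppSign-range {n} part symm m)) (to (T-sub ℤ._≟_) t _ -j∈))))
      where
      C⊆B : ∀ z → z ∈ map +_ C → z ∈ B
      C⊆B z z∈ with ∈-map⁻ +_ z∈
      ... | c , c∈ , refl = ∈-closed B∈ +i∈ (to (positiveBlocks-sameBlock i c) (sameBlock C∈ i∈ c∈))
      negative∉ : ∀ {j} → 1 ≤ j → ¬ ((ℤ.- (+ j)) ∈ map +_ C)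
      negative∉ {suc j} _ z∈ with ∈-map⁻ +_ z∈
      ... | _ , _ , ()

  ψB-correct : IsPartitionOf [ n ] (proj₁ (ψB π)) × Spec (SameSign π) (OppSign π) (ψB π)
  ψB-correct = Merge.φB-correct (isNCB⇒signedNonCrossing ncb) positiveBlocks-partition
    positiveBlocks-sameBlock (mixedᵇ π) mixedᵇ⇔

-- The inverse map

signed : Bool → ℕ → ℤ
signed b i = if b then + i else ℤ.- (+ i)

∣signed∣ : ∀ b i → ∣ signed b i ∣ ≡ i
∣signed∣ true i = refl
∣signed∣ false i = ℤ.∣-i∣≡∣i∣ (+ i)

neg-signed : ∀ b i → ℤ.- (signed b i) ≡ signed (not b) i
neg-signed true i = refl
neg-signed false i = ℤ.neg-involutive (+ i)

∣signed∣-injective : ∀ b b' {i j} → signed b i ≡ signed b' j → i ≡ j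
∣signed∣-injective b b' {i} {j} eq = trans (sym (∣signed∣ b i)) (trans (cong ∣_∣ eq) (∣signed∣ b' j))

signed-injective : ∀ b b' {i j} → 1 ≤ i → signed b i ≡ signed b' j → b ≡ b' × i ≡ j
signed-injective b b' {i} {j} 1≤i eq = go b b' 1≤i i≡j eq , i≡j
  where
  i≡j = ∣signed∣-injective b b' eq
  go : ∀ b b' {i j} → 1 ≤ i → i ≡ j → signed b i ≡ signed b' j → b ≡ b'
  go true true _ _ _ = refl
  go false false _ _ _ = refl
  go true false {suc i} _ refl ()
  go false true {suc i} _ refl ()

isZeroᵇ : Mark → List ℕ → Bool
isZeroᵇ (block B) C = setEqℕ C B
isZeroᵇ _ C = false

-- C is cut at the threshold and the signs of the two parts are made opposite: for e = `false` the
-- lower part is positive and the upper one negative. With threshold 0 the halves are just -C and C.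
half : Mark → Bool → List ℕ → List ℤ
half x e C = map (λ c → signed (e xor (c ≤ᵇ threshold x)) c) C

doubled : List ℕ → List ℤ
doubled C = map (signed true) C ++ map (signed false) C

lift : Mark → List ℕ → List (List ℤ)
lift x C = if isZeroᵇ x C then doubled C ∷ [] else half x false C ∷ half x true C ∷ []

ψB⁻¹ : List (List ℕ) × Mark → List (List ℤ)
ψB⁻¹ (σ , x) = concatMap (lift x) σ

data Lifted (x : Mark) (C : List ℕ) : List ℤ → Set where
  whole : T (isZeroᵇ x C) → Lifted x C (doubled C)
  piece : ¬ T (isZeroᵇ x C) → ∀ e → Lifted x C (half x e C)

∈-lift⁻ : ∀ {x C D} → D ∈ lift x C → Lifted x C D
∈-lift⁻ {x} {C} D∈ with isZeroᵇ x C in eq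
∈-lift⁻ (here refl) | true = whole (from T-≡ eq)
∈-lift⁻ (here refl) | false = piece (λ t → contradiction (trans (sym eq) (to T-≡ t)) λ ()) false
∈-lift⁻ (there (here refl)) | false = piece (λ t → contradiction (trans (sym eq) (to T-≡ t)) λ ()) true

∈-lift⁺ : ∀ {x C D} → Lifted x C D → D ∈ lift x C
∈-lift⁺ {x} {C} (whole t) rewrite to T-≡ t = here refl
∈-lift⁺ {x} {C} (piece ¬t e) with isZeroᵇ x C
... | true = ⊥-elim (¬t _)
∈-lift⁺ (piece ¬t false) | false = here refl
∈-lift⁺ (piece ¬t true) | false = there (here refl)

lifted-∈ : ∀ {x C D z} → Lifted x C D → z ∈ D → ∃[ b ] ∃[ i ] i ∈ C × z ≡ signed b i
lifted-∈ {C = C} (whole _) z∈ with ∈-++⁻ (map (signed true) C) z∈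
... | inj₁ z∈ˡ = let i , i∈ , eq = ∈-map⁻ (signed true) z∈ˡ in true , i , i∈ , eq
... | inj₂ z∈ʳ = let i , i∈ , eq = ∈-map⁻ (signed false) z∈ʳ in false , i , i∈ , eq
lifted-∈ (piece _ e) z∈ = let i , i∈ , eq = ∈-map⁻ _ z∈ in _ , i , i∈ , eq

∣lifted∣-∈ : ∀ {x C D z} → Lifted x C D → z ∈ D → ∣ z ∣ ∈ C
∣lifted∣-∈ l z∈ with lifted-∈ l z∈
... | b , i , i∈ , refl = subst (_∈ _) (sym (∣signed∣ b i)) i∈

∈-doubled : ∀ b {C i} → i ∈ C → signed b i ∈ doubled C
∈-doubled true i∈ = ∈-++⁺ˡ (∈-map⁺ (signed true) i∈)
∈-doubled false {C} i∈ = ∈-++⁺ʳ (map (signed true) C) (∈-map⁺ (signed false) i∈)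

doubled-≋-negB : ∀ C → doubled C ≋ negB (doubled C)
doubled-≋-negB C z = mk⇔
  (λ z∈ → subst (_∈ negB (doubled C)) (ℤ.neg-involutive z) (∈-negB (neg∈ z∈)))
  (λ z∈ → subst (_∈ doubled C) (ℤ.neg-involutive z) (neg∈ (∈-negB⁻ z∈)))
  where
  neg∈ : ∀ {z} → z ∈ doubled C → (ℤ.- z) ∈ doubled C
  neg∈ z∈ with ∈-++⁻ (map (signed true) C) z∈
  ... | inj₁ z∈ˡ with ∈-map⁻ (signed true) z∈ˡ
  ... | j , j∈ , refl = ∈-doubled false j∈
  neg∈ z∈ | inj₂ z∈ʳ with ∈-map⁻ (signed false) z∈ʳ
  ... | j , j∈ , refl = subst (_∈ doubled C) (sym (ℤ.neg-involutive (+ j))) (∈-doubled true j∈)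

∈-half⁺ : ∀ {x e C i b} → i ∈ C → b ≡ e xor (i ≤ᵇ threshold x) → signed b i ∈ half x e C
∈-half⁺ i∈ refl = ∈-map⁺ _ i∈

∈-half⁻ : ∀ {x e C i} b → 1 ≤ i → signed b i ∈ half x e C → i ∈ C × b ≡ e xor (i ≤ᵇ threshold x)
∈-half⁻ {x} {e} b 1≤i z∈ with ∈-map⁻ _ z∈
... | j , j∈ , eq with signed-injective b (e xor (j ≤ᵇ threshold x)) 1≤i eq
... | refl , refl = j∈ , refl

-- The bit e, which selects one of the two halves, cancels in the comparison of two signs.
-- Conversely, `xor-solve` finds the half that contains both given signed elements.
xor-same : ∀ {b b'} e u v → b ≡ e xor u → b' ≡ e xor v → b xor b' ≡ u xor v
xor-same true true true refl refl = refl
xor-same true true false refl refl = refl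
xor-same true false true refl refl = refl
xor-same true false false refl refl = refl
xor-same false u v refl refl = refl

xor-solve : ∀ b b' u v → b xor b' ≡ u xor v → ∃[ e ] b ≡ e xor u × b' ≡ e xor v
xor-solve true true true true _ = false , refl , refl
xor-solve true true false false _ = true , refl , refl
xor-solve true false true false _ = false , refl , refl
xor-solve true false false true _ = true , refl , refl
xor-solve false true true false _ = true , refl , refl
xor-solve false true false true _ = false , refl , refl
xor-solve false false true true _ = true , refl , refl
xor-solve false false false false _ = false , refl , refl

module _ {n : ℕ} {σ : List (List ℕ)} {x : Mark} (p : IsPartitionOf [ n ] σ) (valid : RelValid (SameBlock σ) x) where
  open Partition p

  private
    π = ψB⁻¹ (σ , x)
    θ = threshold x

    ∈π⁻ : ∀ {D} → D ∈ π → ∃[ C ] C ∈ σ × Lifted x C D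
    ∈π⁻ D∈ = let C , C∈ , D∈C = find (∈-concatMap⁻ (lift x) {xs = σ} D∈) in C , C∈ , ∈-lift⁻ D∈C

    ∈π⁺ : ∀ {C D} → C ∈ σ → Lifted x C D → D ∈ π
    ∈π⁺ C∈ l = ∈-concatMap⁺ (lift x) (lose C∈ (∈-lift⁺ l))

    elem≥1 : ∀ {C i} → C ∈ σ → i ∈ C → 1 ≤ i
    elem≥1 C∈ i∈ = proj₁ (∈-[]⁻ (within _ _ C∈ i∈))

  isZero⇔InZero : ∀ {C i} → C ∈ σ → i ∈ C → T (isZeroᵇ x C) ⇔ InZero x i
  isZero⇔InZero {C} {i} C∈ i∈ = go x valid
    where
    go : ∀ x → RelValid (SameBlock σ) x → T (isZeroᵇ x C) ⇔ InZero x i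
    go none _ = mk⇔ (λ t → t) (λ t → t)
    go (edge _ _) _ = mk⇔ (λ t → t) (λ t → t)
    go (block B) (_ , cl) = mk⇔ (λ t → to (to T-setEqℕ t i) i∈)
      (λ i∈B → from (T-setEqℕ {C}) λ j → mk⇔ (λ j∈ → to (cl i j i∈B) (sameBlock C∈ i∈ j∈))
                                        (λ j∈ → ∈-closed C∈ i∈ (from (cl i j i∈B) j∈)))

  -- Stated for arbitrary signs, so that one computation serves `SignP` (equal signs), `SignM`
  -- (opposite signs) and the covering property.
  ψB⁻¹-sameBlock : ∀ b b' {i j} → 1 ≤ i → 1 ≤ j → SameBlock π (signed b i) (signed b' j) ⇔
    (SameBlock σ i j × (InZero x i ⊎ b xor b' ≡ (i ≤ᵇ θ) xor (j ≤ᵇ θ)))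
  ψB⁻¹-sameBlock b b' {i} {j} 1≤i 1≤j = mk⇔ fwd bwd
    where
    abs∈ : ∀ {C D b i} → Lifted x C D → signed b i ∈ D → i ∈ C
    abs∈ {b = b} {i} l z∈ = subst (_∈ _) (∣signed∣ b i) (∣lifted∣-∈ l z∈)

    fwd : SameBlock π (signed b i) (signed b' j) → SameBlock σ i j × (InZero x i ⊎ b xor b' ≡ (i ≤ᵇ θ) xor (j ≤ᵇ θ))
    fwd s with find s
    ... | D , D∈ , i∈ , j∈ with ∈π⁻ D∈
    ... | C , C∈ , l@(whole t) =
      sameBlock C∈ (abs∈ {b = b} l i∈) (abs∈ {b = b'} l j∈) , inj₁ (to (isZero⇔InZero C∈ (abs∈ {b = b} l i∈)) t)
    ... | C , C∈ , piece _ e =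
      let i∈C , eq = ∈-half⁻ {x} {e} b 1≤i i∈
          j∈C , eq' = ∈-half⁻ {x} {e} b' 1≤j j∈
      in sameBlock C∈ i∈C j∈C , inj₂ (xor-same e (i ≤ᵇ θ) (j ≤ᵇ θ) eq eq')

    bwd : SameBlock σ i j × (InZero x i ⊎ b xor b' ≡ (i ≤ᵇ θ) xor (j ≤ᵇ θ)) → SameBlock π (signed b i) (signed b' j)
    bwd (s , c) with find s
    ... | C , C∈ , i∈ , j∈ with T? (isZeroᵇ x C) | c
    ... | yes t | _ = sameBlock (∈π⁺ C∈ (whole t)) (∈-doubled b i∈) (∈-doubled b' j∈)
    ... | no ¬t | inj₁ iz = ⊥-elim (¬t (from (isZero⇔InZero C∈ i∈) iz))
    ... | no ¬t | inj₂ eq =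
      let e , eqi , eqj = xor-solve b b' _ _ eq
      in sameBlock (∈π⁺ C∈ (piece ¬t e)) (∈-half⁺ {x} {e} i∈ eqi) (∈-half⁺ {x} {e} j∈ eqj)

  private
    signed∈ : ∀ {i} b → i ∈ [ n ] → signed b i ∈ [± n ]
    signed∈ true i∈ = let 1≤i , i≤n = ∈-[]⁻ i∈ in ∈-[±]⁺ (pos 1≤i i≤n)
    signed∈ false i∈ = let 1≤i , i≤n = ∈-[]⁻ i∈ in ∈-[±]⁺ (neg 1≤i i≤n)

    ⇒signed : ∀ {z} → Signed n z → ∃[ b ] ∃[ i ] z ≡ signed b i × i ∈ [ n ]
    ⇒signed (pos 1≤m m≤n) = true , _ , refl , ∈-[]⁺ 1≤m m≤n
    ⇒signed (neg 1≤m m≤n) = false , _ , refl , ∈-[]⁺ 1≤m m≤n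

    lifted-nonempty : ∀ {C D} → C ∈ σ → Lifted x C D → D ≢ []
    lifted-nonempty C∈ l with ∃∈-block C∈
    lifted-nonempty C∈ (whole _) | i , i∈ = ∈⇒≢[] (∈-doubled true i∈)
    lifted-nonempty C∈ (piece _ e) | i , i∈ = ∈⇒≢[] (∈-half⁺ {x} {e} i∈ refl)

    lifted-unique : ∀ {C D} → C ∈ σ → Lifted x C D → Unique D
    lifted-unique {C} C∈ (piece _ e) = Unique.map⁺
      (λ {i} {j} → ∣signed∣-injective (e xor (i ≤ᵇ θ)) (e xor (j ≤ᵇ θ)))
      (All.lookup blocksAreSets C∈)
    lifted-unique {C} C∈ (whole _) = Unique.++⁺ (Unique.map⁺ (∣signed∣-injective true true) u)
      (Unique.map⁺ (∣signed∣-injective false false) u)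
      λ { (z∈ , z∈') → apart (∈-map⁻ (signed true) z∈) (∈-map⁻ (signed false) z∈') }
      where
      u = All.lookup blocksAreSets C∈
      apart : ∀ {z} → ∃[ i ] i ∈ C × z ≡ signed true i → ∃[ j ] j ∈ C × z ≡ signed false j → ⊥
      -- Elements of σ are at least 1, which rules out the coincidence of +0 and -0.
      apart (i , i∈ , refl) (j , _ , eq) with signed-injective true false {i} {j} (elem≥1 C∈ i∈) eq
      ... | () , _

    lift-disjoint : ∀ {C} → C ∈ σ → AllPairs Disjoint (lift x C)
    lift-disjoint {C} C∈ with isZeroᵇ x C
    ... | true = [] ∷ []
    ... | false = (apart ∷ []) ∷ [] ∷ []
      where
      apart : Disjoint (half x false C) (half x true C)
      apart z z∈ z∈' with ∈-map⁻ _ z∈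
      ... | i , i∈ , refl with ∈-half⁻ {x} {true} (i ≤ᵇ θ) (elem≥1 C∈ i∈) z∈'
      ... | _ , eq with i ≤ᵇ θ
      apart z z∈ z∈' | i , i∈ , refl | _ , () | true
      apart z z∈ z∈' | i , i∈ , refl | _ , () | false

    concatMap-disjoint : ∀ {τ} → (∀ {C} → C ∈ τ → C ∈ σ) → AllPairs Disjoint τ → AllPairs Disjoint (concatMap (lift x) τ)
    concatMap-disjoint {[]} _ _ = []
    concatMap-disjoint {C ∷ τ} sub (d ∷ ds) = AllPairs.++⁺ (lift-disjoint (sub (here refl)))
      (concatMap-disjoint (sub ∘ there) ds)
      (All.tabulate λ D∈ → All.tabulate λ E∈ z z∈D z∈E →
        let C' , C'∈ , E∈C' = find (∈-concatMap⁻ (lift x) {xs = τ} E∈)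
        in All.lookup d C'∈ _ (∣lifted∣-∈ (∈-lift⁻ {x} {C} D∈) z∈D) (∣lifted∣-∈ (∈-lift⁻ {x} {C'} E∈C') z∈E))

    cover : ∀ z → z ∈ [± n ] → Any (z ∈_) π
    cover z z∈ with ⇒signed (∈-[±]⁻ {n} z∈)
    ... | b , i , refl , i∈ = Any.map proj₁ (from (ψB⁻¹-sameBlock b b 1≤i 1≤i)
        (sameBlock-refl i∈ , inj₂ (xor-self b (i ≤ᵇ θ))))
      where
      1≤i = proj₁ (∈-[]⁻ i∈)
      xor-self : ∀ b u → b xor b ≡ u xor u
      xor-self true true = refl
      xor-self true false = refl
      xor-self false true = refl
      xor-self false false = refl

  ψB⁻¹-partition : IsPartitionOf [± n ] π
  ψB⁻¹-partition = record
    { nonempty = All.tabulate λ D∈ → let _ , C∈ , l = ∈π⁻ D∈ in lifted-nonempty C∈ l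
    ; blocksAreSets = All.tabulate λ D∈ → let _ , C∈ , l = ∈π⁻ D∈ in lifted-unique C∈ l
    ; disjoint = concatMap-disjoint (λ C∈ → C∈) disjoint
    ; covers = cover
    ; within = λ z D D∈ z∈ →
        let C , C∈ , l = ∈π⁻ D∈
            b , i , i∈ , eq = lifted-∈ l z∈
        in subst (_∈ [± n ]) (sym eq) (signed∈ b (within i C C∈ i∈)) }

  -- Negation exchanges the two halves of an unmarked block and fixes the doubled block.
  ψB⁻¹-symmetric : ∀ D → D ∈ π → Any (_≋ negB D) π
  ψB⁻¹-symmetric D D∈ with ∈π⁻ D∈
  ... | C , C∈ , whole t = lose (∈π⁺ C∈ (whole t)) (doubled-≋-negB C)
  ... | C , C∈ , piece ¬t e = lose (∈π⁺ C∈ (piece ¬t (not e))) λ z → mk⇔ (fwd z) (bwd z)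
    where
    not-xor : ∀ e u → not (e xor u) ≡ not e xor u
    not-xor true true = refl
    not-xor true false = refl
    not-xor false u = refl
    flip∈ : ∀ {i} → i ∈ C → (ℤ.- (signed (not e xor (i ≤ᵇ θ)) i)) ∈ half x e C
    flip∈ {i} i∈ = subst (_∈ half x e C) (sym (neg-signed (not e xor (i ≤ᵇ θ)) i))
      (∈-half⁺ {x} {e} i∈ (not-not e (i ≤ᵇ θ)))
      where
      not-not : ∀ e u → not (not e xor u) ≡ e xor u
      not-not true u = refl
      not-not false true = refl
      not-not false false = refl
    fwd : ∀ z → z ∈ half x (not e) C → z ∈ negB (half x e C)
    fwd z z∈ with ∈-map⁻ _ z∈
    ... | i , i∈ , refl = subst (_∈ negB (half x e C)) (ℤ.neg-involutive _) (∈-negB (flip∈ i∈))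
    bwd : ∀ z → z ∈ negB (half x e C) → z ∈ half x (not e) C
    bwd z z∈ with ∈-map⁻ (ℤ.-_) z∈
    ... | _ , w∈ , refl with ∈-map⁻ _ w∈
    ... | i , i∈ , refl = subst (_∈ half x (not e) C) (sym (neg-signed (e xor (i ≤ᵇ θ)) i))
      (∈-half⁺ {x} {not e} i∈ (not-xor e (i ≤ᵇ θ)))

  private
    xor-same⇒≡ : ∀ u v → true xor true ≡ u xor v → u ≡ v
    xor-same⇒≡ true true _ = refl
    xor-same⇒≡ false false _ = refl

    ≡⇒xor-same : ∀ u v → u ≡ v → true xor true ≡ u xor v
    ≡⇒xor-same true _ refl = refl
    ≡⇒xor-same false _ refl = refl

    xor-opp⇒≡ : ∀ u v → true xor false ≡ u xor v → u ≡ not v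
    xor-opp⇒≡ true false _ = refl
    xor-opp⇒≡ false true _ = refl

    ≡⇒xor-opp : ∀ u v → u ≡ not v → true xor false ≡ u xor v
    ≡⇒xor-opp _ true refl = refl
    ≡⇒xor-opp _ false refl = refl

    symm : Symmetric π
    symm = symmetric⇒Symmetric ψB⁻¹-symmetric

    σ-range : ∀ {i j} → SameBlock σ i j → 1 ≤ i × 1 ≤ j
    σ-range s = proj₁ (∈-[]⁻ (sameBlock-within s)) , proj₁ (∈-[]⁻ (sameBlock-within (sameBlock-sym s)))

  ψB⁻¹-sameSign : ∀ i j → SignP (SameBlock σ) x i j ⇔ SameSign π i j
  ψB⁻¹-sameSign i j = mk⇔
    (λ { (s , c) → let 1≤i , 1≤j = σ-range s in
         from (ψB⁻¹-sameBlock true true 1≤i 1≤j) (s , [ inj₁ , inj₂ ∘ ≡⇒xor-same _ _ ]′ c) })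
    (λ t → let s , c = to (ψB⁻¹-sameBlock true true (proj₁ (+-range {n} ψB⁻¹-partition t))
                             (proj₁ (+-range {n} ψB⁻¹-partition (sameBlock-sym t)))) t
           in s , [ inj₁ , inj₂ ∘ xor-same⇒≡ _ _ ]′ c)

  ψB⁻¹-oppSign : ∀ i j → SignM (SameBlock σ) x i j ⇔ OppSign π i j
  ψB⁻¹-oppSign i j = mk⇔
    (λ { (s , c) → let 1≤i , 1≤j = σ-range s in
         from (ψB⁻¹-sameBlock true false 1≤i 1≤j) (s , [ inj₁ , inj₂ ∘ ≡⇒xor-opp _ _ ]′ c) })
    (λ t → let s , c = to (ψB⁻¹-sameBlock true false (proj₁ (+-range {n} ψB⁻¹-partition t))
                             (proj₁ (oppSign-range {n} ψB⁻¹-partition symm t))) t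
           in s , [ inj₁ , inj₂ ∘ xor-opp⇒≡ _ _ ]′ c)

  ψB⁻¹-spec : NonCrossing (SameBlock σ) → Spec (SameSign π) (OppSign π) (σ , x)
  ψB⁻¹-spec nc = spec-resp ψB⁻¹-sameSign ψB⁻¹-oppSign (sign-spec nc valid)

  ψB⁻¹-isNCB : NonCrossing (SameBlock σ) → IsNCB n π
  ψB⁻¹-isNCB nc = signed⇒isNCB ψB⁻¹-partition symm
    (signed-resp ψB⁻¹-sameSign ψB⁻¹-oppSign (sign-signedNonCrossing nc valid)) ψB⁻¹-symmetric

-- Types

-- No two entries of xs share a match, so a match of the head can be deleted from ys without
-- affecting the remaining entries.
matching⇒length≤ : ∀ {A B : Set} {R : A → B → Set} {xs ys} →
  (∀ {x} → x ∈ xs → ∃[ y ] y ∈ ys × R x y) → AllPairs (λ x x' → ∀ {y} → R x y → R x' y → ⊥) xs →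
  length xs ≤ length ys
matching⇒length≤ {xs = []} _ _ = z≤n
matching⇒length≤ {R = R} {x ∷ xs} {ys} total (x≢ ∷ uniq) with total (here refl)
... | y , y∈ , r with ∈-∃++ y∈
... | us , vs , refl = ≤-trans (s≤s (matching⇒length≤ total' uniq)) (≤-reflexive (sym length-insert))
  where
  length-insert : length (us ++ y ∷ vs) ≡ suc (length (us ++ vs))
  length-insert = trans (length-++ us) (trans (+-suc (length us) (length vs)) (cong suc (sym (length-++ us))))
  total' : ∀ {x'} → x' ∈ xs → ∃[ y' ] y' ∈ us ++ vs × R x' y'
  total' x'∈ with total (there x'∈)
  ... | y' , y'∈ , r' with ∈-++⁻ us y'∈
  ... | inj₁ y'∈us = y' , ∈-++⁺ˡ y'∈us , r'
  ... | inj₂ (here refl) = ⊥-elim (All.lookup x≢ x'∈ r r')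
  ... | inj₂ (there y'∈vs) = y' , ∈-++⁺ʳ us y'∈vs , r'

≋⇒length≡ : ∀ {A : Set} {B C : List A} → Unique B → Unique C → B ≋ C → length B ≡ length C
≋⇒length≡ uB uC B≋C = ≤-antisym
  (matching⇒length≤ {R = _≡_} (λ x∈ → _ , to (B≋C _) x∈ , refl) (AllPairs.map (λ { ne refl refl → ne refl }) uB))
  (matching⇒length≤ {R = _≡_} (λ x∈ → _ , from (B≋C _) x∈ , refl) (AllPairs.map (λ { ne refl refl → ne refl }) uC))

module _ {A : Set} {S : List A} {P Q : List (List A)} (p : IsPartitionOf S P) (q : IsPartitionOf S Q)
         (P⇔Q : P ≈ₚ Q) where
  private
    module P = Partition p
    module Q = Partition q

  same-block : ∀ {B} → B ∈ P → ∃[ C ] C ∈ Q × B ≋ C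
  same-block B∈ =
    let a , a∈ = P.∃∈-block B∈
        C , C∈ , a∈C , _ = find (to (P⇔Q a a) (sameBlock B∈ a∈ a∈))
    in C , C∈ , λ b → mk⇔ (λ b∈ → Q.∈-closed C∈ a∈C (to (P⇔Q a b) (sameBlock B∈ a∈ b∈)))
                          (λ b∈ → P.∈-closed B∈ a∈ (from (P⇔Q a b) (sameBlock C∈ a∈C b∈)))

  -- Types count lists, while partitions are compared only through their common-block relations;
  -- blocks are therefore matched by equality as sets. Two uses of this bound give equal counts.
  length-filterᵇ-≤ : (f : List A → Bool) → (∀ {B C} → B ∈ P → C ∈ Q → B ≋ C → T (f B) → T (f C)) →
    length (filterᵇ f P) ≤ length (filterᵇ f Q)
  length-filterᵇ-≤ f resp = matching⇒length≤ {R = _≋_} total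
    (allPairs-map-∈ distinct (AllPairs.filter⁺ (T? ∘ f) P.disjoint))
    where
    total : ∀ {B} → B ∈ filterᵇ f P → ∃[ C ] C ∈ filterᵇ f Q × B ≋ C
    total B∈f =
      let B∈ , fB = ∈-filter⁻ (T? ∘ f) {xs = P} B∈f
          C , C∈ , B≋C = same-block B∈
      in C , ∈-filter⁺ (T? ∘ f) C∈ (resp B∈ C∈ B≋C fB) , B≋C
    distinct : ∀ {B B'} → B ∈ filterᵇ f P → B' ∈ filterᵇ f P → Disjoint B B' → ∀ {C} → B ≋ C → B' ≋ C → ⊥
    distinct B∈f _ d B≋C B'≋C =
      let b , b∈ = P.∃∈-block (proj₁ (∈-filter⁻ (T? ∘ f) {xs = P} B∈f))
      in d b b∈ (from (B'≋C b) (to (B≋C b) b∈))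

nonzeroOfSize : ℕ → List ℤ → Bool
nonzeroOfSize i B = not (setEqℤ B (negB B)) ∧ (length B ≡ᵇ i)

negB-≋ : ∀ {B C} → B ≋ C → negB B ≋ negB C
negB-≋ {B} {C} e z = mk⇔ (go (λ w → to (e w))) (go (λ w → from (e w)))
  where
  go : ∀ {B C} → (∀ w → w ∈ B → w ∈ C) → z ∈ negB B → z ∈ negB C
  go f z∈ with ∈-map⁻ (ℤ.-_) z∈
  ... | w , w∈ , refl = ∈-negB (f w w∈)

typeB-≈ : ∀ {n π π'} → IsPartitionOf [± n ] π → IsPartitionOf [± n ] π' → π ≈ₚ π' →
  ∀ i → typeB π i ≡ typeB π' i
typeB-≈ {n} {π} {π'} p p' π≈π' i = cong (_/ 2) (≤-antisym
  (length-filterᵇ-≤ p p' π≈π' (nonzeroOfSize i) (resp p p'))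
  (length-filterᵇ-≤ p' p (λ a b → mk⇔ (from (π≈π' a b)) (to (π≈π' a b))) (nonzeroOfSize i) (resp p' p)))
  where
  resp : ∀ {π π'} → IsPartitionOf [± n ] π → IsPartitionOf [± n ] π' →
    ∀ {B C} → B ∈ π → C ∈ π' → B ≋ C → T (nonzeroOfSize i B) → T (nonzeroOfSize i C)
  resp p p' {B} {C} B∈ C∈ B≋C t =
    let nz , len = to T-∧ t in from T-∧
      ( T-not⁺ (λ z → T-not⁻ nz (from (T-setEqℤ {B}) λ a →
          let zC = to (T-setEqℤ {C}) z a
              nB = negB-≋ B≋C a
          in mk⇔ (λ a∈ → from nB (to zC (to (B≋C a) a∈))) (λ a∈ → from (B≋C a) (from zC (to nB a∈)))))
      , subst (λ k → T (k ≡ᵇ i)) (≋⇒length≡ (All.lookup (IsPartitionOf.blocksAreSets p) B∈)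
                                            (All.lookup (IsPartitionOf.blocksAreSets p') C∈) B≋C) len )

count-single : ∀ {A : Set} (f : A → Bool) {x} → f x ≡ false → length (filterᵇ f (x ∷ [])) ≡ 0
count-single f {x} eq with f x
count-single f refl | false = refl

count-pair : ∀ {A : Set} (f : A → Bool) {x y b} → f x ≡ b → f y ≡ b →
  length (filterᵇ f (x ∷ y ∷ [])) ≡ (if b then 2 else 0)
count-pair f {x} {y} eq eq' with f x | eq
... | true | refl with f y | eq'
... | true | refl = refl
count-pair f {x} {y} eq eq' | false | refl with f y | eq'
... | false | refl = refl

unmarkedOfSize : Mark → ℕ → List ℕ → Bool
unmarkedOfSize x i C = not (isZeroᵇ x C) ∧ (length C ≡ᵇ i)

module _ {n : ℕ} {σ : List (List ℕ)} (p : IsPartitionOf [ n ] σ) (x : Mark) (i : ℕ) where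
  open Partition p

  private
    θ = threshold x

    -- A half contains each element of C with one sign only, and the nonempty C provides an element
    -- to test.
    half-nonzero : ∀ {C} e → C ∈ σ → setEqℤ (half x e C) (negB (half x e C)) ≡ false
    half-nonzero {C} e C∈ with setEqℤ (half x e C) (negB (half x e C)) in eq
    ... | false = refl
    ... | true with ∃∈-block C∈
    ... | j , j∈ = contradiction (proj₂ (∈-half⁻ {x} {e} (not b) (proj₁ (∈-[]⁻ (within j C C∈ j∈))) -z∈)) (not≢ b)
      where
      b = e xor (j ≤ᵇ θ)
      not≢ : ∀ b → not b ≢ b
      not≢ true ()
      not≢ false ()
      -z∈ : signed (not b) j ∈ half x e C
      -z∈ = subst (_∈ half x e C) (neg-signed b j)
        (∈-negB⁻ (to (to (T-setEqℤ {half x e C}) (from T-≡ eq) _) (∈-half⁺ {x} {e} j∈ refl)))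

    -- An unmarked block of size i contributes two nonzero blocks of that size, and the doubled
    -- block none; the factor 2 is the one that `typeB` divides out.
    count-lift : ∀ {C} → C ∈ σ →
      length (filterᵇ (nonzeroOfSize i) (lift x C)) ≡ (if unmarkedOfSize x i C then 2 else 0)
    count-lift {C} C∈ with isZeroᵇ x C
    ... | true = count-single (nonzeroOfSize i) {doubled C} (cong (λ b → not b ∧ (length (doubled C) ≡ᵇ i)) (to T-≡ (from (T-setEqℤ {doubled C}) (doubled-≋-negB C))))
    ... | false = count-pair (nonzeroOfSize i) {half x false C} {half x true C} (size false) (size true)
      where
      size : ∀ e → nonzeroOfSize i (half x e C) ≡ (length C ≡ᵇ i)
      size e = cong₂ (λ b l → not b ∧ (l ≡ᵇ i)) (half-nonzero e C∈) (length-map _ C)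

    count-concatMap : ∀ τ → (∀ {C} → C ∈ τ → C ∈ σ) →
      length (filterᵇ (nonzeroOfSize i) (concatMap (lift x) τ)) ≡ length (filterᵇ (unmarkedOfSize x i) τ) * 2
    count-concatMap [] _ = refl
    count-concatMap (C ∷ τ) sub
      rewrite filter-++ (T? ∘ nonzeroOfSize i) (lift x C) (concatMap (lift x) τ)
            | length-++ (filterᵇ (nonzeroOfSize i) (lift x C)) {filterᵇ (nonzeroOfSize i) (concatMap (lift x) τ)}
            | count-lift (sub (here refl)) | count-concatMap τ (sub ∘ there)
      with unmarkedOfSize x i C
    ... | true = refl
    ... | false = refl

  typeB-ψB⁻¹ : typeB (ψB⁻¹ (σ , x)) i ≡ length (filterᵇ (unmarkedOfSize x i) σ)
  typeB-ψB⁻¹ = trans (cong (_/ 2) (count-concatMap σ (λ C∈ → C∈))) (m*n/n≡m _ 2)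

filterᵇ-filterᵇ : ∀ {A : Set} (p q : A → Bool) xs → filterᵇ (λ x → p x ∧ q x) xs ≡ filterᵇ q (filterᵇ p xs)
filterᵇ-filterᵇ p q [] = refl
filterᵇ-filterᵇ p q (x ∷ xs) with p x
... | false = filterᵇ-filterᵇ p q xs
... | true with q x
... | true = cong (x ∷_) (filterᵇ-filterᵇ p q xs)
... | false = filterᵇ-filterᵇ p q xs

typeClause : ∀ {π} y → (∀ i → typeB π i ≡ length (filterᵇ (unmarkedOfSize (proj₂ y) i) (proj₁ y))) → TypeClause π y
typeClause (σ , none) h = h
typeClause (σ , edge _ _) h = h
typeClause (σ , block B) h i =
  trans (h i) (cong length (filterᵇ-filterᵇ (λ C → not (setEqℕ C B)) (λ C → length C ≡ᵇ i) σ))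

-- Both signed relations are given by the same threshold formulas in σ and x, and by symmetry they
-- determine the whole partition.
spec⇒≈ₚ : ∀ {n π π' y} → IsNCB n π → IsNCB n π' →
  Spec (SameSign π) (OppSign π) y → Spec (SameSign π') (OppSign π') y → π ≈ₚ π'
spec⇒≈ₚ {n} ncb ncb' spec spec' a b = mk⇔ (half-≈ ncb ncb' spec spec') (half-≈ ncb' ncb spec' spec)
  where
  half-≈ : ∀ {π π'} → IsNCB n π → IsNCB n π' →
    Spec (SameSign π) (OppSign π) _ → Spec (SameSign π') (OppSign π') _ → SameBlock π a b → SameBlock π' a b
  half-≈ ncb ncb' spec spec' = ≈ₚ-signed {n} (IsNCB.partition ncb)
    (symmetric⇒Symmetric (IsNCB.symmetric ncb)) (symmetric⇒Symmetric (IsNCB.symmetric ncb'))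
    (λ i j p → from (P⇔SignP (isNCB⇒signedNonCrossing ncb') spec' i j) (to (P⇔SignP (isNCB⇒signedNonCrossing ncb) spec i j) p))
    (λ i j m → from (M⇔SignM (isNCB⇒signedNonCrossing ncb') spec' i j) (to (M⇔SignM (isNCB⇒signedNonCrossing ncb) spec i j) m))

-- The bijection and the types

ψB-spec : ∀ {n π} → IsNCB n π → Spec (SameSign π) (OppSign π) (ψB π)
ψB-spec ncb = proj₂ (ψB-correct ncb)

ψB-nonCrossing : ∀ {n π} → IsNCB n π → NonCrossing (SameBlock (proj₁ (ψB π)))
ψB-nonCrossing ncb =
  nonCrossing-resp (λ i j → mk⇔ (from (same i j)) (to (same i j))) (union-nonCrossing (isNCB⇒signedNonCrossing ncb))
  where same = proj₁ (ψB-spec ncb)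

ψB-relValid : ∀ {n π} → IsNCB n π → RelValid (SameBlock (proj₁ (ψB π))) (proj₂ (ψB π))
ψB-relValid {π = π} ncb =
  relValid-resp (λ i j → mk⇔ (from (same i j)) (to (same i j))) (proj₂ (ψB π))
    (markSpec⇒relValid (isNCB⇒signedNonCrossing ncb) (proj₂ (ψB π)) (proj₂ (ψB-spec ncb)))
  where same = proj₁ (ψB-spec ncb)

ψB-inFrakB : ∀ {n π} → IsNCB n π → InFrakB n (ψB π)
ψB-inFrakB {n} {π} ncb =
  nonCrossing⇒isNC part (ψB-nonCrossing ncb) , relValid⇒validMark part (proj₂ (ψB π)) (ψB-relValid ncb)
  where part = proj₁ (ψB-correct ncb)

ψB-cong : ∀ {n π π'} → IsNCB n π → IsNCB n π' → π ≈ₚ π' → ψB π ≈𝔅 ψB π'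
ψB-cong {π = π} {π'} ncb ncb' π≈π' = spec-unique (isNCB⇒signedNonCrossing ncb')
  (spec-resp (λ i j → π≈π' (+ i) (+ j)) (λ i j → π≈π' (+ i) (ℤ.- (+ j))) (ψB-spec ncb)) (ψB-spec ncb')

ψB-injective : ∀ {n π π'} → IsNCB n π → IsNCB n π' → ψB π ≈𝔅 ψB π' → π ≈ₚ π'
ψB-injective ncb ncb' y≈y' = spec⇒≈ₚ ncb ncb' (ψB-spec ncb) (spec-≈ y≈y' (ψB-spec ncb'))

-- For π = `ψB⁻¹ y` both `ψB π` and y satisfy `Spec` for the relations of π, so uniqueness
-- identifies them.
ψB-surjective : ∀ {n} y → InFrakB n y → ∃[ π ] (IsNCB n π × (ψB π ≈𝔅 y))
ψB-surjective y@(σ , x) (nc , v) = ψB⁻¹ y , ncb ,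
  spec-unique (isNCB⇒signedNonCrossing ncb) (ψB-spec ncb) (ψB⁻¹-spec part valid cross)
  where
  part = IsNC.partition nc
  valid = validMark⇒relValid part x v
  cross = isNC⇒nonCrossing nc
  ncb = ψB⁻¹-isNCB part valid cross

-- π and `ψB⁻¹ (ψB π)` satisfy `Spec` with the same value, hence are the same partition, and the
-- type is counted on the latter.
ψB-type : ∀ {n π} → IsNCB n π → TypeClause π (ψB π)
ψB-type {n} {π} ncb = typeClause {π} (ψB π) λ i →
  trans (typeB-≈ {n} (IsNCB.partition ncb) (IsNCB.partition ncb') (spec⇒≈ₚ ncb ncb' (ψB-spec ncb) (ψB⁻¹-spec part valid cross)) i)
        (typeB-ψB⁻¹ part (proj₂ (ψB π)) i)
  where
  part = proj₁ (ψB-correct ncb)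
  valid = ψB-relValid ncb
  cross = ψB-nonCrossing ncb
  ncb' = ψB⁻¹-isNCB part valid cross

theorem6p2 : (n : ℕ) → 1 ≤ n →
    ((π : _) → IsNCB n π → InFrakB n (ψB π))
    × ((π π' : _) → IsNCB n π → IsNCB n π' → π ≈ₚ π' → ψB π ≈𝔅 ψB π')
    × ((π π' : _) → IsNCB n π → IsNCB n π' → ψB π ≈𝔅 ψB π' → π ≈ₚ π')
    × ((y : _) → InFrakB n y → ∃[ π ] (IsNCB n π × (ψB π ≈𝔅 y)))
    × ((π : _) → IsNCB n π → TypeClause π (ψB π))
theorem6p2 n _ =
  (λ _ → ψB-inFrakB) , (λ _ _ → ψB-cong) , (λ _ _ → ψB-injective) , ψB-surjective , (λ _ → ψB-type)
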